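{- Let $\mathbf{X}$ be a computably discrete represented space. The following are equivalent: (1) $\mathbf{X}$ admits a computably equivalent representation with domain $\mathbb{N}^{\mathbb{N}}$, i.e. there is a total surjection $\delta':\mathbb{N}^{\mathbb{N}}\to X$ such that the identity map is computable both from $(X,\delta')$ to $\mathbf{X}$ and from $\mathbf{X}$ to $(X,\delta')$. (2) There exists a computable surjection $s:\mathbb{N}\to\mathbf{X}$. (3) $\mathbf{X}$ is computably Quasi-Polish. (4) $\mathbf{X}$ is computably isomorphic to a computably discrete quotient $\mathbb{N}/R$ of $\mathbb{N}$ by some equivalence relation $R$. (5) $\mathbf{X}$ is computably isomorphic to a computably admissible quotient $\mathbb{N}/R$ of $\mathbb{N}$ by some equivalence relation $R$.
   Context: A represented space $\mathbf{X}=(X,\delta_{\mathbf{X}})$ is a set $X$ with a partial surjection $\delta_{\mathbf{X}}:\subseteq\mathbb{N}^{\mathbb{N}}\to X$; any $p$ with $\delta_{\mathbf X}(p)=x$ is a name of $x$. A realiser of a map $f:\mathbf{X}\to\mathbf{Y}$ is a partial map $R_f:\subseteq\mathbb{N}^{\mathbb{N}}\to\mathbb{N}^{\mathbb{N}}$ sending every name of every $x\in X$ to a name of $f(x)$; $f$ is computable (continuously realisable) if it has a computable (continuous) realiser. A computable isomorphism is a computable bijection with computable inverse. $\mathbb{N}$ is represented by $\delta_{\mathbb N}(p)=p(0)$. $\mathbf{Y}^{\mathbf{X}}$ is the represented space of total continuously realisable functions; a name of $f$ is a $p\in\mathbb N^{\mathbb N}$ coding a realiser of $f$, with $p(0)$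 the index of a Turing machine using the oracle $n\mapsto p(n+1)$. In the product $\mathbf{X}\times\mathbf{Y}$, $p$ names $(x,y)$ iff $n\mapsto p(2n)$ names $x$ and $n\mapsto p(2n+1)$ names $y$. Sierpinski space $\mathbb{S}=\{\top,\bot\}$ is represented so that $0^\omega$ names $\bot$ and every other sequence names $\top$. The space $\mathcal{O}(\mathbf{X})$ of open sets is $\mathbb{S}^{\mathbf{X}}$, identifying $U$ with its characteristic function ($x\mapsto\top$ iff $x\in U$); $U$ is computably open if it is a computable point of $\mathcal O(\mathbf X)$ (i.e. has a computable name). $\mathbf{X}$ is computably discrete if the diagonal of $\mathbf X\times\mathbf X$ is computably open, i.e. equality is semidecidable. $\mathbf{X}$ is computably admissible if the map $\mathbf{X}\to\mathcal{O}(\mathcal{O}(\mathbf{X}))$, $x\mapsto\{U\in\mathcal{O}(\mathbf{X})\mid x\in U\}$, has a computable partial inverse (defined on its image). $\mathbf{X}$ is computably overt if non-emptiness of a given $U\in\mathcal{O}(\mathbf{X})$ is semidecidable, i.e. $\{U\in\mathcal O(\mathbf X)\mid U\neq\emptyset\}$ is computably open in $\mathcal{O}(\mathbf{X})$. For a transitive relation $\ll$ on $\mathbb{N}$, an ideal is a non-empty $I\subseteq\mathbb{N}$ such that $x\ll y\in I$ implies $x\in I$, and for all $x,y\in I$ there is $z\in I$ with $x\ll z$ and $y\ll z$. $\mathbf{I}(\ll)$ is the represented space of ideals, where $p$ names $I$ iff $I=\{p(k)\mid k\in\mathbb{N}\}$. A represented space is precomputably Quasi-Polish if it is computably isomorphic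 to $\mathbf{I}(\ll)$ for some computably enumerable transitive relation $\ll$ on $\mathbb N$; it is computably Quasi-Polish if it is moreover computably overt. For an equivalence relation $R$ on $\mathbb{N}$, the quotient $\mathbb{N}/R$ is the represented space of $R$-classes where a name of a class is a name of any of its elements.
   Formalization: The space X is assumed non-empty: the empty space is computably discrete and computably Quasi-Polish (it is I(≪) for the empty relation), so (3) holds for it while (1), (2), (4) and (5) fail. -}

module Defs where

open import Axiom.ExcludedMiddle using (ExcludedMiddle)
open import Data.Empty using (⊥-elim)
open import Data.Nat using (ℕ; zero; suc; _+_; _*_; _<_)
open import Data.Nat.Properties
  using (+-suc; +-identityʳ; suc-injective; <-cmp)
open import Data.Product using (Σ; Σ-syntax; ∃; ∃-syntax; _×_; _,_; proj₁; proj₂)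
open import Data.Product.Relation.Binary.Pointwise.NonDependent using (_×ₛ_)
open import Function.Bundles
  using (Func; _⟨$⟩_; _⇔_; mk⇔; Equivalence; Surjection)
import Function.Construct.Composition as Composition
import Function.Construct.Identity as Identity
import Function.Construct.Symmetry as Symmetry
open import Function.Definitions using (Inverseᵇ)
open import Function.Relation.Binary.Setoid.Equality using (_⇨_)
open import Level using (Level; 0ℓ; _⊔_) renaming (suc to lsuc)
open import Relation.Binary.Bundles using (Setoid)
open import Relation.Binary.Core using (Rel; REL)
import Relation.Binary.Construct.On as On
open import Relation.Binary.Definitions using (Transitive; tri<; tri≈; tri>)
open import Relation.Binary.PropositionalEquality
  using (_≡_; _≗_; refl; sym; trans; cong; cong₂; subst; setoid; _→-setoid_)
open import Relation.Binary.Structures using (IsEquivalence)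
open import Relation.Nullary using (¬_; yes; no)
open import Relation.Unary using (Pred)

private
  variable
    c ℓ r c′ ℓ′ r′ k : Level

triangle : ℕ → ℕ
triangle zero    = zero
triangle (suc n) = suc (n + triangle n)

pair : ℕ → ℕ → ℕ
pair x y = y + triangle (x + y)

next : ℕ × ℕ → ℕ × ℕ
next (zero  , y) = suc y , zero
next (suc x , y) = x , suc y

unpair : ℕ → ℕ × ℕ
unpair zero    = zero , zero
unpair (suc n) = next (unpair n)

π₁ π₂ : ℕ → ℕ
π₁ n = proj₁ (unpair n)
π₂ n = proj₂ (unpair n)

private
  unpair-pair′ : ∀ s x y → x + y ≡ s → unpair (pair x y) ≡ (x , y)
  unpair-pair′ zero    zero    zero    _  = refl
  unpair-pair′ (suc s) (suc x) zero    eq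
    rewrite +-identityʳ x | suc-injective eq
    = cong next (unpair-pair′ s zero s refl)
  unpair-pair′ s       x       (suc y) eq
    rewrite +-suc x y
    = cong next (unpair-pair′ s (suc x) y eq)

unpair-pair : ∀ x y → unpair (pair x y) ≡ (x , y)
unpair-pair x y = unpair-pair′ (x + y) x y refl

pair-injective : ∀ {x y x′ y′} → pair x y ≡ pair x′ y′ → (x ≡ x′) × (y ≡ y′)
pair-injective {x} {y} {x′} {y′} eq = cong proj₁ eq′ , cong proj₂ eq′
  where
  eq′ : (x , y) ≡ (x′ , y′)
  eq′ = trans (sym (unpair-pair x y)) (trans (cong unpair eq) (unpair-pair x′ y′))

-- Oracle machines, presented as Kleene's partial recursive functions
-- relative to an oracle.  All programs are unary; several arguments are
-- passed through the Cantor pairing.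

Baire : Set
Baire = ℕ → ℕ

data Code : Set where
  zeroᶜ succᶜ leftᶜ rightᶜ oracleᶜ : Code
  pairᶜ compᶜ precᶜ                : Code → Code → Code
  muᶜ                              : Code → Code

-- p ⊢ e [ x ]⇓ y : program e with oracle p halts on input x with output y.

infix 4 _⊢_[_]⇓_

data _⊢_[_]⇓_ (p : Baire) : Code → ℕ → ℕ → Set where
  zero⇓   : ∀ {x} → p ⊢ zeroᶜ [ x ]⇓ 0
  succ⇓   : ∀ {x} → p ⊢ succᶜ [ x ]⇓ suc x
  left⇓   : ∀ {x} → p ⊢ leftᶜ [ x ]⇓ π₁ x
  right⇓  : ∀ {x} → p ⊢ rightᶜ [ x ]⇓ π₂ x
  oracle⇓ : ∀ {x} → p ⊢ oracleᶜ [ x ]⇓ p x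
  pair⇓   : ∀ {d e x y z} →
            p ⊢ d [ x ]⇓ y → p ⊢ e [ x ]⇓ z → p ⊢ pairᶜ d e [ x ]⇓ pair y z
  comp⇓   : ∀ {d e x y z} →
            p ⊢ e [ x ]⇓ y → p ⊢ d [ y ]⇓ z → p ⊢ compᶜ d e [ x ]⇓ z
  -- precᶜ d e computes h with h(a,0) = d(a), h(a,n+1) = e(a,(n,h(a,n))).
  prec⇓₀  : ∀ {d e x y} → π₂ x ≡ 0 →
            p ⊢ d [ π₁ x ]⇓ y → p ⊢ precᶜ d e [ x ]⇓ y
  prec⇓₊  : ∀ {d e x n y z} → π₂ x ≡ suc n →
            p ⊢ precᶜ d e [ pair (π₁ x) n ]⇓ y →
            p ⊢ e [ pair (π₁ x) (pair n y) ]⇓ z →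
            p ⊢ precᶜ d e [ x ]⇓ z
  -- muᶜ d computes x ↦ μn. d(x,n) = 0.
  mu⇓     : ∀ {d x n} →
            (∀ m → m < n → ∃[ y ] p ⊢ d [ pair x m ]⇓ suc y) →
            p ⊢ d [ pair x n ]⇓ 0 →
            p ⊢ muᶜ d [ x ]⇓ n

encode : Code → ℕ
encode zeroᶜ       = pair 0 0
encode succᶜ       = pair 1 0
encode leftᶜ       = pair 2 0
encode rightᶜ      = pair 3 0
encode oracleᶜ     = pair 4 0
encode (pairᶜ d e) = pair 5 (pair (encode d) (encode e))
encode (compᶜ d e) = pair 6 (pair (encode d) (encode e))
encode (precᶜ d e) = pair 7 (pair (encode d) (encode e))
encode (muᶜ d)     = pair 8 (encode d)

private
  tag : Code → ℕ
  tag zeroᶜ       = 0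
  tag succᶜ       = 1
  tag leftᶜ       = 2
  tag rightᶜ      = 3
  tag oracleᶜ     = 4
  tag (pairᶜ _ _) = 5
  tag (compᶜ _ _) = 6
  tag (precᶜ _ _) = 7
  tag (muᶜ _)     = 8

  payload : Code → ℕ
  payload (pairᶜ d e) = pair (encode d) (encode e)
  payload (compᶜ d e) = pair (encode d) (encode e)
  payload (precᶜ d e) = pair (encode d) (encode e)
  payload (muᶜ d)     = encode d
  payload _           = 0

  encode-tag : ∀ d → encode d ≡ pair (tag d) (payload d)
  encode-tag zeroᶜ       = refl
  encode-tag succᶜ       = refl
  encode-tag leftᶜ       = refl
  encode-tag rightᶜ      = refl
  encode-tag oracleᶜ     = refl
  encode-tag (pairᶜ _ _) = refl
  encode-tag (compᶜ _ _) = refl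
  encode-tag (precᶜ _ _) = refl
  encode-tag (muᶜ _)     = refl

  tag-payload : ∀ d d′ → encode d ≡ encode d′ →
                (tag d ≡ tag d′) × (payload d ≡ payload d′)
  tag-payload d d′ eq =
    pair-injective (trans (sym (encode-tag d)) (trans eq (encode-tag d′)))

mutual
  encode-injective : ∀ {d d′} → encode d ≡ encode d′ → d ≡ d′
  encode-injective {d} {d′} eq =
    let t , q = tag-payload d d′ eq in by-tag d d′ t q

  private
    by-tag : ∀ d d′ → tag d ≡ tag d′ → payload d ≡ payload d′ → d ≡ d′
    by-tag zeroᶜ zeroᶜ _ _ = refl
    by-tag succᶜ succᶜ _ _ = refl
    by-tag leftᶜ leftᶜ _ _ = refl
    by-tag rightᶜ rightᶜ _ _ = refl
    by-tag oracleᶜ oracleᶜ _ _ = refl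
    by-tag (pairᶜ d e) (pairᶜ d′ e′) _ eq =
      let u , v = pair-injective eq
      in cong₂ pairᶜ (encode-injective {d} {d′} u) (encode-injective {e} {e′} v)
    by-tag (compᶜ d e) (compᶜ d′ e′) _ eq =
      let u , v = pair-injective eq
      in cong₂ compᶜ (encode-injective {d} {d′} u) (encode-injective {e} {e′} v)
    by-tag (precᶜ d e) (precᶜ d′ e′) _ eq =
      let u , v = pair-injective eq
      in cong₂ precᶜ (encode-injective {d} {d′} u) (encode-injective {e} {e′} v)
    by-tag (muᶜ d) (muᶜ d′) _ eq = cong muᶜ (encode-injective {d} {d′} eq)

⇓-functional : ∀ {p e x y z} → p ⊢ e [ x ]⇓ y → p ⊢ e [ x ]⇓ z → y ≡ z
⇓-functional zero⇓   zero⇓   = refl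
⇓-functional succ⇓   succ⇓   = refl
⇓-functional left⇓   left⇓   = refl
⇓-functional right⇓  right⇓  = refl
⇓-functional oracle⇓ oracle⇓ = refl
⇓-functional (pair⇓ s t) (pair⇓ s′ t′) =
  cong₂ pair (⇓-functional s s′) (⇓-functional t t′)
⇓-functional (comp⇓ s t) (comp⇓ s′ t′) with refl ← ⇓-functional s s′ =
  ⇓-functional t t′
⇓-functional (prec⇓₀ _ s) (prec⇓₀ _ s′) = ⇓-functional s s′
⇓-functional (prec⇓₀ a _) (prec⇓₊ b _ _) with () ← trans (sym a) b
⇓-functional (prec⇓₊ a _ _) (prec⇓₀ b _) with () ← trans (sym a) b
⇓-functional (prec⇓₊ a s t) (prec⇓₊ b s′ t′)
  with refl ← suc-injective (trans (sym a) b)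
  with refl ← ⇓-functional s s′ = ⇓-functional t t′
⇓-functional (mu⇓ {n = m} f s) (mu⇓ {n = n} g t) with <-cmp m n
... | tri≈ _ eq _ = eq
... | tri< m<n _ _ with () ← ⇓-functional s (proj₂ (g m m<n))
... | tri> _ _ n<m with () ← ⇓-functional t (proj₂ (f n n<m))

⇓-resp-≗ : ∀ {p q e x y} → p ≗ q → p ⊢ e [ x ]⇓ y → q ⊢ e [ x ]⇓ y
⇓-resp-≗ eq zero⇓   = zero⇓
⇓-resp-≗ eq succ⇓   = succ⇓
⇓-resp-≗ eq left⇓   = left⇓
⇓-resp-≗ eq right⇓  = right⇓
⇓-resp-≗ {q = q} eq (oracle⇓ {x}) =
  subst (q ⊢ oracleᶜ [ x ]⇓_) (sym (eq x)) oracle⇓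
⇓-resp-≗ eq (pair⇓ s t)    = pair⇓ (⇓-resp-≗ eq s) (⇓-resp-≗ eq t)
⇓-resp-≗ eq (comp⇓ s t)    = comp⇓ (⇓-resp-≗ eq s) (⇓-resp-≗ eq t)
⇓-resp-≗ eq (prec⇓₀ a s)   = prec⇓₀ a (⇓-resp-≗ eq s)
⇓-resp-≗ eq (prec⇓₊ a s t) = prec⇓₊ a (⇓-resp-≗ eq s) (⇓-resp-≗ eq t)
⇓-resp-≗ eq (mu⇓ f s)      =
  mu⇓ (λ m m<n → proj₁ (f m m<n) , ⇓-resp-≗ eq (proj₂ (f m m<n))) (⇓-resp-≗ eq s)

-- Partial maps on Baire space are given by their graphs.

⟦_⟧ : Code → Rel Baire 0ℓ
⟦ e ⟧ p q = ∀ n → p ⊢ e [ n ]⇓ q n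

noOracle : Baire
noOracle _ = 0

ComputableSequence : Pred Baire 0ℓ
ComputableSequence q = ∃[ e ] ⟦ e ⟧ noOracle q

-- Computable enumerability, as the domain of a partial computable function.

ComputablyEnumerable : Rel ℕ 0ℓ → Set
ComputablyEnumerable _≪_ =
  ∃[ e ] ∀ x y → (x ≪ y) ⇔ (∃[ z ] noOracle ⊢ e [ pair x y ]⇓ z)

tail : Baire → Baire
tail p n = p (suc n)

evens odds : Baire → Baire
evens p n = p (2 * n)
odds  p n = p (suc (2 * n))

⟨_,_⟩ : Baire → Baire → Baire
⟨ p , q ⟩ zero    = p zero
⟨ p , q ⟩ (suc n) = ⟨ q , tail p ⟩ n

⟨,⟩-cong : ∀ {p p′ q q′} → p ≗ p′ → q ≗ q′ → ⟨ p , q ⟩ ≗ ⟨ p′ , q′ ⟩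
⟨,⟩-cong a b zero    = a zero
⟨,⟩-cong a b (suc n) = ⟨,⟩-cong b (λ m → a (suc m)) n

evens-⟨,⟩ : ∀ p q → evens ⟨ p , q ⟩ ≗ p
evens-⟨,⟩ p q zero = refl
evens-⟨,⟩ p q (suc n) rewrite +-suc n (n + 0) = evens-⟨,⟩ (tail p) (tail q) n

odds-⟨,⟩ : ∀ p q → odds ⟨ p , q ⟩ ≗ q
odds-⟨,⟩ p q zero = refl
odds-⟨,⟩ p q (suc n) rewrite +-suc n (n + 0) = odds-⟨,⟩ (tail p) (tail q) n

-- Represented spaces.  The underlying set is a setoid, and the partial
-- surjection δ is given by its graph: p ⊩ x means δ(p) = x.

record RepresentedSpace (c ℓ r : Level) : Set (lsuc (c ⊔ ℓ ⊔ r)) where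
  infix 4 _⊩_
  field
    points : Setoid c ℓ
  open Setoid points public using (Carrier; _≈_)
  field
    _⊩_        : REL Baire Carrier r
    ⊩-resp     : ∀ {p q x y} → p ≗ q → x ≈ y → p ⊩ x → q ⊩ y
    functional : ∀ {p x y} → p ⊩ x → p ⊩ y → x ≈ y
    surjective : ∀ x → ∃[ p ] p ⊩ x

open RepresentedSpace using (points; Carrier)

Map : RepresentedSpace c ℓ r → RepresentedSpace c′ ℓ′ r′ → Set (c ⊔ ℓ ⊔ c′ ⊔ ℓ′)
Map X Y = Func (points X) (points Y)

module _ (X : RepresentedSpace c ℓ r) (Y : RepresentedSpace c′ ℓ′ r′) where
  private
    module X = RepresentedSpace X
    module Y = RepresentedSpace Y

  IsRealiser : Rel Baire 0ℓ → Map X Y → Set (c ⊔ r ⊔ r′)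
  IsRealiser F f = ∀ {p x} → p X.⊩ x → ∃[ q ] F p q × q Y.⊩ (f ⟨$⟩ x)

  Computable : Map X Y → Set (c ⊔ r ⊔ r′)
  Computable f = ∃[ e ] IsRealiser ⟦ e ⟧ f

  -- p(0) is an index of a program, which is run with access to both
  -- n ↦ p(n+1) and the input q.

  CodesRealiser : Baire → Map X Y → Set (c ⊔ r ⊔ r′)
  CodesRealiser p f =
    ∃[ e ] (encode e ≡ p 0) × IsRealiser (λ q → ⟦ e ⟧ ⟨ tail p , q ⟩) f

infix 4 _≅_

record _≅_ (X : RepresentedSpace c ℓ r) (Y : RepresentedSpace c′ ℓ′ r′)
  : Set (c ⊔ ℓ ⊔ r ⊔ c′ ⊔ ℓ′ ⊔ r′) where
  private
    module X = RepresentedSpace X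
    module Y = RepresentedSpace Y
  field
    to              : Map X Y
    from            : Map Y X
    inverse         : Inverseᵇ X._≈_ Y._≈_ (to ⟨$⟩_) (from ⟨$⟩_)
    to-computable   : Computable X Y to
    from-computable : Computable Y X from

ComputablePoint : (X : RepresentedSpace c ℓ r) → Carrier X → Set r
ComputablePoint X x = ∃[ p ] p ⊩ x × ComputableSequence p
  where open RepresentedSpace X

ℕʳ : RepresentedSpace 0ℓ 0ℓ 0ℓ
ℕʳ = record
  { points     = setoid ℕ
  ; _⊩_        = λ p n → p 0 ≡ n
  ; ⊩-resp     = λ { p≗q refl refl → sym (p≗q 0) }
  ; functional = λ a b → trans (sym a) b
  ; surjective = λ n → (λ _ → n) , refl
  }

data Sierpinski : Set where
  ⊤ ⊥ : Sierpinski

𝕊 : RepresentedSpace 0ℓ 0ℓ 0ℓ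
𝕊 = record
  { points     = setoid Sierpinski
  ; _⊩_        = _names_
  ; ⊩-resp     = resp _ _
  ; functional = fun _ _
  ; surjective = λ { ⊤ → (λ _ → 1) , (λ f → 1≢0 (f 0)) ; ⊥ → (λ _ → 0) , (λ _ → refl) }
  }
  where
  _names_ : Baire → Sierpinski → Set
  p names ⊥ = ∀ n → p n ≡ 0
  p names ⊤ = ¬ (∀ n → p n ≡ 0)

  1≢0 : ¬ (1 ≡ 0)
  1≢0 ()

  resp : ∀ x y {p q} → p ≗ q → x ≡ y → p names x → q names y
  resp ⊤ .⊤ p≗q refl a = λ f → a (λ n → trans (p≗q n) (f n))
  resp ⊥ .⊥ p≗q refl a = λ n → trans (sym (p≗q n)) (a n)

  fun : ∀ x y {p} → p names x → p names y → x ≡ y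
  fun ⊤ ⊤ _ _ = refl
  fun ⊥ ⊥ _ _ = refl
  fun ⊤ ⊥ a b = ⊥-elim (a b)
  fun ⊥ ⊤ a b = ⊥-elim (b a)

infixr 2 _×ʳ_

_×ʳ_ : RepresentedSpace c ℓ r → RepresentedSpace c′ ℓ′ r′ →
       RepresentedSpace (c ⊔ c′) (ℓ ⊔ ℓ′) (r ⊔ r′)
X ×ʳ Y = record
  { points     = X.points ×ₛ Y.points
  ; _⊩_        = λ { p (x , y) → evens p X.⊩ x × odds p Y.⊩ y }
  ; ⊩-resp     = λ { p≗q (x≈ , y≈) (a , b) →
                     X.⊩-resp (λ n → p≗q (2 * n)) x≈ a ,
                     Y.⊩-resp (λ n → p≗q (suc (2 * n))) y≈ b }
  ; functional = λ { (a , b) (a′ , b′) → X.functional a a′ , Y.functional b b′ }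
  ; surjective = λ { (x , y) →
      let p , a = X.surjective x
          q , b = Y.surjective y
      in ⟨ p , q ⟩ ,
         X.⊩-resp (λ n → sym (evens-⟨,⟩ p q n)) SX.refl a ,
         Y.⊩-resp (λ n → sym (odds-⟨,⟩ p q n)) SY.refl b }
  }
  where
  module X = RepresentedSpace X
  module SX = Setoid X.points
  module Y = RepresentedSpace Y
  module SY = Setoid Y.points

Subspace : (X : RepresentedSpace c ℓ r) → Pred (Carrier X) k →
           RepresentedSpace (c ⊔ k) ℓ r
Subspace X P = record
  { points     = On.setoid {B = Σ X.Carrier P} X.points proj₁
  ; _⊩_        = λ p x → p X.⊩ proj₁ x
  ; ⊩-resp     = X.⊩-resp
  ; functional = X.functional
  ; surjective = λ x → X.surjective (proj₁ x)
  }
  where module X = RepresentedSpace X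

-- The function space Yˣ.  A function is continuously realisable iff it has
-- a realiser computable relative to some oracle, that is, iff it has a name.

Exp : RepresentedSpace c ℓ r → RepresentedSpace c′ ℓ′ r′ →
      RepresentedSpace (c ⊔ ℓ ⊔ r ⊔ c′ ⊔ ℓ′ ⊔ r′) (c ⊔ ℓ′) (c ⊔ r ⊔ r′)
Exp X Y = record
  { points     = On.setoid {B = Σ[ f ∈ Map X Y ] ∃[ p ] CodesRealiser X Y p f}
                           (X.points ⇨ Y.points) proj₁
  ; _⊩_        = λ p f → CodesRealiser X Y p (proj₁ f)
  ; ⊩-resp     = λ { p≗q f≈g (e , e≡ , real) →
      e , trans e≡ (p≗q 0) , λ {_} {x} a →
        let q′ , run , b = real a in
        q′ ,
        (λ n → ⇓-resp-≗ (⟨,⟩-cong (λ m → p≗q (suc m)) (λ _ → refl)) (run n)) ,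
        Y.⊩-resp (λ _ → refl) (f≈g x) b }
  ; functional = λ { {p} {f} {g} → fun {p} {proj₁ f} {proj₁ g} }
  ; surjective = proj₂
  }
  where
  module X = RepresentedSpace X
  module Y = RepresentedSpace Y

  fun : ∀ {p f g} → CodesRealiser X Y p f → CodesRealiser X Y p g →
        ∀ x → (f ⟨$⟩ x) Y.≈ (g ⟨$⟩ x)
  fun (e , e≡ , real) (e′ , e′≡ , real′) x
    with refl ← encode-injective {e} {e′} (trans e≡ (sym e′≡)) =
    let _ , a        = X.surjective x
        _ , run , b  = real a
        _ , run′ , d = real′ a
    in Y.functional
         (Y.⊩-resp (λ n → ⇓-functional (run n) (run′ n)) (Setoid.refl Y.points) b) d

𝒪 : RepresentedSpace c ℓ r → RepresentedSpace (c ⊔ ℓ ⊔ r) c (c ⊔ r)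
𝒪 X = Exp X 𝕊

module _ (X : RepresentedSpace c ℓ r) where

  infix 4 _∈_

  _∈_ : Carrier X → Carrier (𝒪 X) → Set
  x ∈ (U , _) = U ⟨$⟩ x ≡ ⊤

  ComputablyOpen : Pred (Carrier X) k → Set (c ⊔ ℓ ⊔ r ⊔ k)
  ComputablyOpen P =
    ∃[ U ] (∀ x → (x ∈ U) ⇔ P x) × ComputablePoint (𝒪 X) U

ComputablyDiscrete : RepresentedSpace c ℓ r → Set (c ⊔ ℓ ⊔ r)
ComputablyDiscrete X = ComputablyOpen (X ×ʳ X) λ { (x , y) → x ≈ y }
  where open RepresentedSpace X

ComputablyOvert : RepresentedSpace c ℓ r → Set (c ⊔ ℓ ⊔ r)
ComputablyOvert X = ComputablyOpen (𝒪 X) λ U → ∃[ x ] _∈_ X x U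

-- V is the set {U | x ∈ U}.  The map κ : X → 𝒪(𝒪(X)) sending x to {U | x ∈ U}
-- enters through its graph, so that κ need not be built to define its image.

IsNeighbourhoodsOf : (X : RepresentedSpace c ℓ r) →
                     Carrier (𝒪 (𝒪 X)) → Carrier X → Set (c ⊔ ℓ ⊔ r)
IsNeighbourhoodsOf X V x = ∀ U → (_∈_ (𝒪 X) U V) ⇔ (_∈_ X x U)

ComputablyAdmissible : RepresentedSpace c ℓ r → Set (c ⊔ ℓ ⊔ r)
ComputablyAdmissible X =
  Σ[ g ∈ Map Image X ]
    (∀ V x (v : IsNeighbourhoodsOf X V x) → (g ⟨$⟩ (V , x , v)) ≈ x) ×
    Computable Image X g
  where
  open RepresentedSpace X using (_≈_)
  Image = Subspace (𝒪 (𝒪 X)) λ V → ∃[ x ] IsNeighbourhoodsOf X V x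

record Ideal (_≪_ : Rel ℕ 0ℓ) : Set₁ where
  field
    member   : Pred ℕ 0ℓ
    nonEmpty : ∃ member
    lower    : ∀ {x y} → x ≪ y → member y → member x
    directed : ∀ {x y} → member x → member y →
               ∃[ z ] member z × (x ≪ z) × (y ≪ z)

open Ideal using (member; nonEmpty)

-- Excluded middle is used only to see that every ideal has a name.

𝐈 : ExcludedMiddle 0ℓ → Rel ℕ 0ℓ → RepresentedSpace (lsuc 0ℓ) 0ℓ 0ℓ
𝐈 em _≪_ = record
  { points     = record
    { Carrier       = Ideal _≪_
    ; _≈_           = λ I J → ∀ n → member I n ⇔ member J n
    ; isEquivalence = record
      { refl  = λ _ → Identity.equivalence _
      ; sym   = λ a n → Symmetry.equivalence (a n)
      ; trans = λ a b n → Composition.equivalence (a n) (b n)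
      }
    }
  ; _⊩_        = λ p I → ∀ n → member I n ⇔ (∃[ k ] p k ≡ n)
  ; ⊩-resp     = λ p≗q I≈J a n → mk⇔
      (λ m → let k , eq = Equivalence.to (a n) (Equivalence.from (I≈J n) m)
             in k , trans (sym (p≗q k)) eq)
      (λ { (k , eq) → Equivalence.to (I≈J n)
                        (Equivalence.from (a n) (k , trans (p≗q k) eq)) })
  ; functional = λ a b n →
      Composition.equivalence (a n) (Symmetry.equivalence (b n))
  ; surjective = λ I → enum I , λ n → mk⇔
      (λ m → n , hit I n m)
      (λ { (k , eq) → subst (member I) eq (sound I k) })
  }
  where
  enum : Ideal _≪_ → Baire
  enum I k with em {member I k}
  ... | yes _ = k
  ... | no  _ = proj₁ (nonEmpty I)

  hit : ∀ I n → member I n → enum I n ≡ n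
  hit I n m with em {member I n}
  ... | yes _ = refl
  ... | no ¬m = ⊥-elim (¬m m)

  sound : ∀ I k → member I (enum I k)
  sound I k with em {member I k}
  ... | yes m = m
  ... | no  _ = proj₂ (nonEmpty I)

PrecomputablyQuasiPolish : ExcludedMiddle 0ℓ → RepresentedSpace c ℓ r →
                           Set (lsuc 0ℓ ⊔ c ⊔ ℓ ⊔ r)
PrecomputablyQuasiPolish em X =
  Σ[ R ∈ Rel ℕ 0ℓ ]
    Transitive R × ComputablyEnumerable R × (X ≅ 𝐈 em R)

ComputablyQuasiPolish : ExcludedMiddle 0ℓ → RepresentedSpace c ℓ r →
                        Set (lsuc 0ℓ ⊔ c ⊔ ℓ ⊔ r)
ComputablyQuasiPolish em X = PrecomputablyQuasiPolish em X × ComputablyOvert X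

ℕ/ : (R : Rel ℕ 0ℓ) → IsEquivalence R → RepresentedSpace 0ℓ 0ℓ 0ℓ
ℕ/ R isEq = record
  { points     = record { isEquivalence = isEq }
  ; _⊩_        = λ p n → ∃[ m ] (p ℕʳ.⊩ m) × R m n
  ; ⊩-resp     = λ { p≗q x≈y (m , a , b) → m , ℕʳ.⊩-resp p≗q refl a , R.trans b x≈y }
  ; functional = λ { (_ , refl , b) (_ , refl , d) → R.trans (R.sym b) d }
  ; surjective = λ n → let p , a = ℕʳ.surjective n in p , n , a , R.refl
  }
  where
  module R = IsEquivalence isEq
  module ℕʳ = RepresentedSpace ℕʳ

BaireSetoid : Setoid 0ℓ 0ℓ
BaireSetoid = ℕ →-setoid ℕ

withTotal : (X : RepresentedSpace c ℓ r) → Surjection BaireSetoid (points X) →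
            RepresentedSpace c ℓ ℓ
withTotal X δ′ = record
  { points     = X.points
  ; _⊩_        = λ p x → δ.to p X.≈ x
  ; ⊩-resp     = λ p≗q x≈y a → S.trans (δ.cong (λ n → sym (p≗q n))) (S.trans a x≈y)
  ; functional = λ a b → S.trans (S.sym a) b
  ; surjective = δ.strictlySurjective
  }
  where
  module X = RepresentedSpace X
  module S = Setoid X.points
  module δ = Surjection δ′

HasTotalRepresentation : RepresentedSpace c ℓ r → Set (c ⊔ ℓ ⊔ r)
HasTotalRepresentation X =
  Σ[ δ′ ∈ Surjection BaireSetoid (points X) ]
    Computable (withTotal X δ′) X (Identity.function (points X)) ×
    Computable X (withTotal X δ′) (Identity.function (points X))

HasComputableEnumeration : RepresentedSpace c ℓ r → Set (c ⊔ ℓ ⊔ r)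
HasComputableEnumeration X =
  Σ[ s ∈ Surjection (setoid ℕ) (points X) ]
    Computable ℕʳ X (Surjection.function s)

IsDiscreteQuotient : RepresentedSpace c ℓ r → Set (lsuc 0ℓ ⊔ c ⊔ ℓ ⊔ r)
IsDiscreteQuotient X =
  Σ[ R ∈ Rel ℕ 0ℓ ] Σ[ isEq ∈ IsEquivalence R ]
    ComputablyDiscrete (ℕ/ R isEq) × (X ≅ ℕ/ R isEq)

IsAdmissibleQuotient : RepresentedSpace c ℓ r → Set (lsuc 0ℓ ⊔ c ⊔ ℓ ⊔ r)
IsAdmissibleQuotient X =
  Σ[ R ∈ Rel ℕ 0ℓ ] Σ[ isEq ∈ IsEquivalence R ]
    ComputablyAdmissible (ℕ/ R isEq) × (X ≅ ℕ/ R isEq)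

{-# OPTIONS --safe #-}
module Submission where

-- Since X is computably discrete, a search decides which point of an
-- enumeration s : ℕ → X a given name denotes.  Hence an enumeration yields the
-- total representation p ↦ s (p 0), and X is the quotient of ℕ by the c.e.
-- equivalence relation R = {(i , j) | s i = s j}, whose classes are exactly its
-- ideals.  Conversely, acceptance of the pair (x , x) by the equality test
-- depends on a finite part of the name of x only, so every computable sequence
-- of points that meets all finite prefixes of names is an enumeration of X.
-- For a total representation these points are named by the sequences
-- k ↦ π₁ (π₂ᵏ m).  For ideals of ≪, overtness enumerates the numbers that
-- belong to some ideal, and each of them starts a computable ≪-chain
-- generating an ideal.  Overtness and admissibility run arbitrary names of open
-- sets, which takes a universal machine.

open import Defs
open import Axiom.ExcludedMiddle using (ExcludedMiddle)
open import Data.Fin using (Fin; zero; suc)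
open import Data.List using (List; []; _∷_)
open import Data.Nat
  using (ℕ; zero; suc; pred; _+_; _*_; _∸_; _⊔_; _≤_; _<_; z≤n; s≤s; s≤s⁻¹)
open import Data.Nat.Induction using (<-wellFounded)
open import Data.Nat.Properties
open import Data.Product using (Σ-syntax; ∃-syntax; _×_; _,_; proj₁; proj₂)
open import Data.Sum using (_⊎_; inj₁; inj₂)
open import Data.Unit using (tt) renaming (⊤ to Unit)
open import Data.Vec using (Vec; []; _∷_; lookup)
open import Function using (_∘_)
open import Function.Bundles
  using (Func; _⟨$⟩_; _⇔_; mk⇔; Equivalence; Surjection)
open import Induction.WellFounded using (Acc; acc)
open import Level using (Level; 0ℓ)
open import Relation.Binary.Bundles using (Setoid)
open import Relation.Binary.Core using (Rel)
open import Relation.Binary.Definitions using (Transitive)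
open import Relation.Binary.PropositionalEquality
  using (_≡_; _≢_; refl; sym; trans; cong; cong₂; subst; subst₂)
open import Relation.Binary.Structures using (IsEquivalence)
open import Relation.Nullary using (yes; no; contradiction)
open import Relation.Nullary.Decidable using (True; decidable-stable; fromWitness; toWitness)
open import Relation.Unary using (Pred)

open RepresentedSpace using (Carrier; _⊩_)

-- A realiser must produce an infinite sequence on every name of a point, while equality, membership
-- and `≪` can only ever be confirmed. Searches therefore run through pairs of a candidate and a
-- stage, with a proof, often classical, that they succeed on names of points; a program that lists
-- a set outputs a known member at stages that confirm nothing. Excluded middle serves existence
-- proofs and the definition of points and relations, never a step of a program. The universal
-- machine also replaces substitution of programs: realisers are composed by simulating one on the
-- oracle computed by the other.

private
  variable
    a c ℓ r c′ ℓ′ r′ ℓᵖ : Level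
    n : ℕ

-- Pairing, primitive recursion and minimisation.

pair-next : ∀ xy → pair (proj₁ (next xy)) (proj₂ (next xy)) ≡ suc (pair (proj₁ xy) (proj₂ xy))
pair-next (zero  , y) rewrite +-identityʳ y = refl
pair-next (suc x , y) rewrite +-suc x y = refl

pair-unpair : ∀ n → pair (π₁ n) (π₂ n) ≡ n
pair-unpair zero    = refl
pair-unpair (suc n) = trans (pair-next (unpair n)) (cong suc (pair-unpair n))

π₁-pair : ∀ x y → π₁ (pair x y) ≡ x
π₁-pair x y = cong proj₁ (unpair-pair x y)

π₂-pair : ∀ x y → π₂ (pair x y) ≡ y
π₂-pair x y = cong proj₂ (unpair-pair x y)

ifz : ℕ → ℕ → ℕ → ℕ
ifz zero    x y = x
ifz (suc _) x y = y

natrec : ℕ → (ℕ → ℕ → ℕ) → ℕ → ℕ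
natrec z s zero    = z
natrec z s (suc n) = s n (natrec z s n)

left-pair⇓ : ∀ {p} x y → p ⊢ leftᶜ [ pair x y ]⇓ x
left-pair⇓ {p} x y = subst (p ⊢ leftᶜ [ pair x y ]⇓_) (π₁-pair x y) left⇓

right-pair⇓ : ∀ {p} x y → p ⊢ rightᶜ [ pair x y ]⇓ y
right-pair⇓ {p} x y = subst (p ⊢ rightᶜ [ pair x y ]⇓_) (π₂-pair x y) right⇓

idᶜ : Code
idᶜ = pairᶜ leftᶜ rightᶜ

id⇓ : ∀ {p x} → p ⊢ idᶜ [ x ]⇓ x
id⇓ {p} {x} = subst (p ⊢ idᶜ [ x ]⇓_) (pair-unpair x) (pair⇓ left⇓ right⇓)

prec-pair⇓₀ : ∀ {p d e y} x → p ⊢ d [ x ]⇓ y → p ⊢ precᶜ d e [ pair x 0 ]⇓ y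
prec-pair⇓₀ {p} {d} {y = y} x s =
  prec⇓₀ (π₂-pair x 0) (subst (p ⊢ d [_]⇓ y) (sym (π₁-pair x 0)) s)

prec-pair⇓₊ : ∀ {p d e y z} x n →
  p ⊢ precᶜ d e [ pair x n ]⇓ y → p ⊢ e [ pair x (pair n y) ]⇓ z →
  p ⊢ precᶜ d e [ pair x (suc n) ]⇓ z
prec-pair⇓₊ {p} {d} {e} {y} {z} x n s t =
  prec⇓₊ (π₂-pair x (suc n))
    (subst (λ w → p ⊢ precᶜ d e [ pair w n ]⇓ y) (sym x≡) s)
    (subst (λ w → p ⊢ e [ pair w (pair n y) ]⇓ z) (sym x≡) t)
  where x≡ = π₁-pair x (suc n)

-- The rule `mu⇓` demands positive values below the result, so a zero obtained by other means has to
-- be minimised first.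
least-zero : ∀ (f : ℕ → ℕ) n → f n ≡ 0 →
  ∃[ m ] f m ≡ 0 × (∀ j → j < m → ∃[ y ] f j ≡ suc y)
least-zero f zero fn≡0 = 0 , fn≡0 , λ _ ()
least-zero f (suc n) fn≡0 with f 0 in f0
... | zero  = 0 , f0 , λ _ ()
... | suc y =
  let m , fm≡0 , below = least-zero (f ∘ suc) n fn≡0
  in suc m , fm≡0 , λ { zero _ → y , f0 ; (suc j) (s≤s j<m) → below j j<m }

-- A language of total programs with variables.

encodeEnv : Vec ℕ n → ℕ
encodeEnv []      = 0
encodeEnv (x ∷ v) = pair x (encodeEnv v)

-- Programs for functions of the variables v.  The oracle o d ranges over a
-- family, so that totality need only hold on, say, names of points of a space.
record Term {D : Set a} (o : D → Baire) (n : ℕ) : Set a where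
  constructor term
  field
    val      : D → Vec ℕ n → ℕ
    code     : Code
    computes : ∀ d v → o d ⊢ code [ encodeEnv v ]⇓ val d v

open Term public

module _ {D : Set a} {o : D → Baire} where

  -- Replaces the raw value of a loop by the function it is meant to compute, so that later proofs
  -- never see the loop.
  ext : (T : Term o n) (f : D → Vec ℕ n → ℕ) → (∀ d v → val T d v ≡ f d v) → Term o n
  ext T f eq = term f (code T) λ d v → subst (o d ⊢ code T [ encodeEnv v ]⇓_) (eq d v) (computes T d v)

  var : Fin n → Term o n
  var i = term (λ _ v → lookup v i) (varᶜ i) (λ _ v → var⇓ i v)
    where
    varᶜ : Fin n → Code
    varᶜ zero    = leftᶜ
    varᶜ (suc i) = compᶜ (varᶜ i) rightᶜ

    var⇓ : ∀ {p} (i : Fin n) v → p ⊢ varᶜ i [ encodeEnv v ]⇓ lookup v i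
    var⇓ zero    (x ∷ v) = left-pair⇓ x (encodeEnv v)
    var⇓ (suc i) (x ∷ v) = comp⇓ (right-pair⇓ x (encodeEnv v)) (var⇓ i v)

  #0 : Term o (1 + n)
  #0 = var zero

  #1 : Term o (2 + n)
  #1 = var (suc zero)

  #2 : Term o (3 + n)
  #2 = var (suc (suc zero))

  const : ℕ → Term o n
  const k = term (λ _ _ → k) (constᶜ k) (λ _ _ → const⇓ k)
    where
    constᶜ : ℕ → Code
    constᶜ zero    = zeroᶜ
    constᶜ (suc k) = compᶜ succᶜ (constᶜ k)

    const⇓ : ∀ {p x} k → p ⊢ constᶜ k [ x ]⇓ k
    const⇓ zero    = zero⇓
    const⇓ (suc k) = comp⇓ (const⇓ k) succ⇓

  sucᵗ fst snd oracle : Term o n → Term o n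
  sucᵗ T = term (λ d v → suc (val T d v)) (compᶜ succᶜ (code T)) λ d v → comp⇓ (computes T d v) succ⇓
  fst T = term (λ d v → π₁ (val T d v)) (compᶜ leftᶜ (code T)) λ d v → comp⇓ (computes T d v) left⇓
  snd T = term (λ d v → π₂ (val T d v)) (compᶜ rightᶜ (code T)) λ d v → comp⇓ (computes T d v) right⇓
  oracle T = term (λ d v → o d (val T d v)) (compᶜ oracleᶜ (code T)) λ d v → comp⇓ (computes T d v) oracle⇓

  ⟪_,_⟫ : Term o n → Term o n → Term o n
  ⟪ S , T ⟫ = term (λ d v → pair (val S d v) (val T d v)) (pairᶜ (code S) (code T))
    λ d v → pair⇓ (computes S d v) (computes T d v)

  Let : Term o n → Term o (suc n) → Term o n
  Let T B = term (λ d v → val B d (val T d v ∷ v)) (compᶜ (code B) (pairᶜ (code T) idᶜ))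
    λ d v → comp⇓ (pair⇓ (computes T d v) id⇓) (computes B d (val T d v ∷ v))

  weaken : Term o n → Term o (suc n)
  weaken {n} T = term val′ (compᶜ (code T) rightᶜ)
    λ { d (x ∷ v) → comp⇓ (right-pair⇓ x (encodeEnv v)) (computes T d v) }
    where
    val′ : D → Vec ℕ (suc n) → ℕ
    val′ d (_ ∷ v) = val T d v

  infixl 9 _at_ _∙_

  -- A computed oracle is a term whose innermost variable is the query; `P at T` poses the query
  -- `T`.
  _at_ : Term o (suc n) → Term o (suc n) → Term o (suc n)
  _at_ {n} P T = term val′ (compᶜ (code P) (pairᶜ (code T) rightᶜ))
    λ { d (x ∷ v) → comp⇓
          (pair⇓ (computes T d (x ∷ v)) (right-pair⇓ x (encodeEnv v)))
          (computes P d (val T d (x ∷ v) ∷ v)) }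
    where
    val′ : D → Vec ℕ (suc n) → ℕ
    val′ d (x ∷ v) = val P d (val T d (x ∷ v) ∷ v)

  -- Weakening at index 1: the query of a computed oracle stays innermost when a search variable is
  -- added to the context.
  under : Term o (suc n) → Term o (2 + n)
  under {n} P = term val′ (compᶜ (code P) (pairᶜ leftᶜ (compᶜ rightᶜ rightᶜ)))
    λ { d (x ∷ y ∷ v) → comp⇓
          (pair⇓ (left-pair⇓ x _) (comp⇓ (right-pair⇓ x _) (right-pair⇓ y (encodeEnv v))))
          (computes P d (x ∷ v)) }
    where
    val′ : D → Vec ℕ (2 + n) → ℕ
    val′ d (x ∷ y ∷ v) = val P d (x ∷ v)

  _∙_ : Term o 1 → Term o n → Term o n
  F ∙ T = term (λ d v → val F d (val T d v ∷ [])) (compᶜ (code F) (pairᶜ (code T) zeroᶜ))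
    λ d v → comp⇓ (pair⇓ (computes T d v) zero⇓) (computes F d (val T d v ∷ []))

  rec : Term o n → Term o n → Term o (2 + n) → Term o n
  rec {n} N Z S = term (λ d v → natrec (val Z d v) (λ m y → val S d (m ∷ y ∷ v)) (val N d v))
    (compᶜ (precᶜ (code Z) (compᶜ (code S) shuffleᶜ)) (pairᶜ idᶜ (code N)))
    λ d v → comp⇓ (pair⇓ id⇓ (computes N d v)) (loop d v (val N d v))
    where
    -- `precᶜ` hands over (environment, (counter, value)), whereas `S` expects counter and value in
    -- front of the environment.
    shuffleᶜ = pairᶜ (compᶜ leftᶜ rightᶜ) (pairᶜ (compᶜ rightᶜ rightᶜ) leftᶜ)

    loop : ∀ d v k → o d ⊢ precᶜ (code Z) (compᶜ (code S) shuffleᶜ) [ pair (encodeEnv v) k ]⇓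
                     natrec (val Z d v) (λ m y → val S d (m ∷ y ∷ v)) k
    loop d v zero    = prec-pair⇓₀ (encodeEnv v) (computes Z d v)
    loop d v (suc k) = prec-pair⇓₊ (encodeEnv v) k (loop d v k)
      (comp⇓ (pair⇓ (comp⇓ (right-pair⇓ e (pair k y)) (left-pair⇓ k y))
                    (pair⇓ (comp⇓ (right-pair⇓ e (pair k y)) (right-pair⇓ k y)) (left-pair⇓ e (pair k y))))
             (computes S d (k ∷ y ∷ v)))
      where
      e = encodeEnv v
      y = natrec (val Z d v) (λ m y → val S d (m ∷ y ∷ v)) k

  caseᵗ : Term o n → Term o n → Term o n → Term o n
  caseᵗ N Z S = ext (rec N Z (weaken (weaken S))) (λ d v → ifz (val N d v) (val Z d v) (val S d v))
    λ d v → lemma (val N d v)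
    where
    lemma : ∀ {x y} k → natrec x (λ _ _ → y) k ≡ ifz k x y
    lemma zero    = refl
    lemma (suc k) = refl

  predᵗ : Term o n → Term o n
  predᵗ N = ext (rec N (const 0) #0) (λ d v → pred (val N d v)) λ d v → lemma (val N d v)
    where
    lemma : ∀ k → natrec 0 (λ m _ → m) k ≡ pred k
    lemma zero    = refl
    lemma (suc k) = refl

  -- The witness in `zero-exists` need not be computable. It only shows that the μ-search halts; the
  -- program finds its own zero.
  module Search (B : Term o (suc n)) (zero-exists : ∀ d v → ∃[ m ] val B d (m ∷ v) ≡ 0) where

    private
      least : ∀ d v → _
      least d v = least-zero (λ m → val B d (m ∷ v)) (proj₁ (zero-exists d v)) (proj₂ (zero-exists d v))

    search : Term o n
    search = term (λ d v → proj₁ (least d v))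
      (muᶜ (compᶜ (code B) (pairᶜ rightᶜ leftᶜ)))
      λ d v → let m , m-zero , below = least d v in
        mu⇓ (λ j j<m → let y , eq = below j j<m in y , body d v j eq) (body d v m m-zero)
      where
      body : ∀ d v m {y} → val B d (m ∷ v) ≡ y →
             o d ⊢ compᶜ (code B) (pairᶜ rightᶜ leftᶜ) [ pair (encodeEnv v) m ]⇓ y
      body d v m refl = comp⇓ (pair⇓ (right-pair⇓ (encodeEnv v) m) (left-pair⇓ (encodeEnv v) m))
                              (computes B d (m ∷ v))

    found : ∀ d v → val B d (val search d v ∷ v) ≡ 0
    found d v = proj₁ (proj₂ (least d v))

  open Search public

  program : Term o 1 → Code
  program T = compᶜ (code T) (pairᶜ idᶜ zeroᶜ)

  sequence : Term o 1 → D → Baire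
  sequence T d k = val T d (k ∷ [])

  program⇓ : ∀ (T : Term o 1) d → ⟦ program T ⟧ (o d) (sequence T d)
  program⇓ T d k = comp⇓ (pair⇓ id⇓ zero⇓) (computes T d (k ∷ []))

-- Arithmetic and interleaving as programs.

module _ {D : Set a} {o : D → Baire} where

  double : Term o n → Term o n
  double N = ext (rec N (const 0) (sucᵗ (sucᵗ #1))) (λ d v → 2 * val N d v) λ d v → lemma (val N d v)
    where
    lemma : ∀ k → natrec 0 (λ _ y → suc (suc y)) k ≡ 2 * k
    lemma zero    = refl
    lemma (suc k) = cong suc (trans (cong suc (lemma k)) (sym (+-suc k (k + 0))))

  monus : Term o n → Term o n → Term o n
  monus M N = ext (rec N M (predᵗ #1)) (λ d v → val M d v ∸ val N d v) λ d v → lemma (val M d v) (val N d v)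
    where
    lemma : ∀ m k → natrec m (λ _ → pred) k ≡ m ∸ k
    lemma m zero    = refl
    lemma m (suc k) = trans (cong pred (lemma m k)) (pred[m∸n]≡m∸[1+n] m k)

  distinct : Term o n → Term o n → Term o n
  distinct M N = caseᵗ (monus M N) (monus N M) (const 1)

distinctℕ : ℕ → ℕ → ℕ
distinctℕ m n = ifz (m ∸ n) (n ∸ m) 1

distinct-refl : ∀ m → distinctℕ m m ≡ 0
distinct-refl m rewrite n∸n≡0 m = refl

distinct⇒≡ : ∀ m n → distinctℕ m n ≡ 0 → m ≡ n
distinct⇒≡ m n eq with m ∸ n in m∸n
... | zero = ≤-antisym (m∸n≡0⇒m≤n m∸n) (m∸n≡0⇒m≤n eq)

parity half : ℕ → ℕ
parity zero    = 0
parity (suc n) = ifz (parity n) 1 0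

half zero    = 0
half (suc n) = ifz (parity n) (half n) (suc (half n))

-- `⟨ p , q ⟩` swaps its arguments at each recursive call; a program needs direct access to the n-th
-- entry instead.
interleave-parity : ∀ p q n → ⟨ p , q ⟩ n ≡ ifz (parity n) (p (half n)) (q (half n))
interleave-parity p q zero    = refl
interleave-parity p q (suc n) rewrite interleave-parity q (tail p) n with parity n
... | zero  = refl
... | suc _ = refl

module _ {D : Set a} {o : D → Baire} where

  parityᵗ halfᵗ : Term o n → Term o n
  parityᵗ N = ext (rec N (const 0) (caseᵗ #1 (const 1) (const 0))) (λ d v → parity (val N d v))
    λ d v → lemma (val N d v)
    where
    lemma : ∀ k → natrec 0 (λ _ b → ifz b 1 0) k ≡ parity k
    lemma zero    = refl
    lemma (suc k) = cong (λ b → ifz b 1 0) (lemma k)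

  halfᵗ N = ext (rec N (const 0) (caseᵗ (parityᵗ #0) #1 (sucᵗ #1))) (λ d v → half (val N d v))
    λ d v → lemma (val N d v)
    where
    lemma : ∀ k → natrec 0 (λ m h → ifz (parity m) h (suc h)) k ≡ half k
    lemma zero    = refl
    lemma (suc k) = cong (λ h → ifz (parity k) h (suc h)) (lemma k)

  interleave : Term o (suc n) → Term o (suc n) → Term o (suc n)
  interleave {n} P Q = ext (caseᵗ (parityᵗ #0) (P at halfᵗ #0) (Q at halfᵗ #0)) val′
    λ { d (k ∷ v) → sym (interleave-parity (λ j → val P d (j ∷ v)) (λ j → val Q d (j ∷ v)) k) }
    where
    val′ : D → Vec ℕ (suc n) → ℕ
    val′ d (k ∷ v) = ⟨ (λ j → val P d (j ∷ v)) , (λ j → val Q d (j ∷ v)) ⟩ k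

-- A stack machine interpreting codes

-- A state is a pair of a current value
-- and a stack of frames.  Frames are code numbers, to be run on the current
-- value, or numbers with one of the fresh tags
--   9  (e , x)  : keep the current value and run e on x,
--   10 x        : pair x with the current value,
--   11 (d , z)  : the current value is that of d at z = (x , n) in a μ-search.

push : ℕ → ℕ → ℕ
push f K = suc (pair f K)

switch : ℕ → List ℕ → ℕ
switch t []       = 0
switch t (x ∷ xs) = ifz t x (switch (pred t) xs)

-- Entries 0 to 8 follow the tags of `encode`, entries 9 to 11 the frame tags. `l₁` and `l₂` are the
-- components of the payload `l`, meaningful only where it is a pair.
dispatch : Baire → (t l l₁ l₂ v K : ℕ) → ℕ
dispatch p t l l₁ l₂ v K = switch t
  ( pair 0 K
  ∷ pair (suc v) K
  ∷ pair (π₁ v) K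
  ∷ pair (π₂ v) K
  ∷ pair (p v) K
  ∷ pair v (push l₁ (push (pair 9 (pair l₂ v)) K))
  ∷ pair v (push l₂ (push l₁ K))
  ∷ ifz (π₂ v)
      (pair (π₁ v) (push l₁ K))
      (pair (pair (π₁ v) (pred (π₂ v)))
        (push (pair 7 l) (push (pair 10 (pred (π₂ v))) (push (pair 10 (π₁ v)) (push l₂ K)))))
  ∷ pair (pair v 0) (push l (push (pair 11 (pair l (pair v 0))) K))
  ∷ pair l₂ (push l₁ (push (pair 10 v) K))
  ∷ pair (pair l v) K
  ∷ ifz v
      (pair (π₂ l₂) K)
      (pair (pair (π₁ l₂) (suc (π₂ l₂)))
        (push l₁ (push (pair 11 (pair l₁ (pair (π₁ l₂) (suc (π₂ l₂))))) K)))
  ∷ [])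

-- The empty stack is 0 and `push` gives successors, so a zero second component marks a halted
-- state, which is a fixed point.
step : Baire → ℕ → ℕ
step p s = ifz (π₂ s) s
  (dispatch p (π₁ (π₁ (pred (π₂ s)))) (π₂ (π₁ (pred (π₂ s))))
    (π₁ (π₂ (π₁ (pred (π₂ s))))) (π₂ (π₂ (π₁ (pred (π₂ s)))))
    (π₁ s) (π₂ (pred (π₂ s))))

module _ {D : Set a} {o : D → Baire} where

  pushᵗ : Term o n → Term o n → Term o n
  pushᵗ F K = sucᵗ ⟪ F , K ⟫

  switchᵗ : Term o n → List (Term o n) → Term o n
  switchᵗ T []       = const 0
  switchᵗ T (F ∷ Fs) = caseᵗ T F (switchᵗ (predᵗ T) Fs)

  stepᵗ : Term o (suc n) → Term o (suc n)
  stepᵗ {n} Q = caseᵗ (snd s) s (switchᵗ t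
    ( ⟪ const 0 , K ⟫
    ∷ ⟪ sucᵗ v , K ⟫
    ∷ ⟪ fst v , K ⟫
    ∷ ⟪ snd v , K ⟫
    ∷ ⟪ Q at v , K ⟫
    ∷ ⟪ v , pushᵗ l₁ (pushᵗ ⟪ const 9 , ⟪ l₂ , v ⟫ ⟫ K) ⟫
    ∷ ⟪ v , pushᵗ l₂ (pushᵗ l₁ K) ⟫
    ∷ caseᵗ (snd v)
        ⟪ fst v , pushᵗ l₁ K ⟫
        ⟪ ⟪ fst v , predᵗ (snd v) ⟫
        , pushᵗ ⟪ const 7 , l ⟫
            (pushᵗ ⟪ const 10 , predᵗ (snd v) ⟫ (pushᵗ ⟪ const 10 , fst v ⟫ (pushᵗ l₂ K))) ⟫
    ∷ ⟪ ⟪ v , const 0 ⟫ , pushᵗ l (pushᵗ ⟪ const 11 , ⟪ l , ⟪ v , const 0 ⟫ ⟫ ⟫ K) ⟫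
    ∷ ⟪ l₂ , pushᵗ l₁ (pushᵗ ⟪ const 10 , v ⟫ K) ⟫
    ∷ ⟪ ⟪ l , v ⟫ , K ⟫
    ∷ caseᵗ v
        ⟪ snd l₂ , K ⟫
        ⟪ z , pushᵗ l₁ (pushᵗ ⟪ const 11 , ⟪ l₁ , z ⟫ ⟫ K) ⟫
    ∷ []))
    where
    s v k K f t l l₁ l₂ z : Term o (suc n)
    s  = #0
    v  = fst s
    k  = predᵗ (snd s)
    K  = snd k
    f  = fst k
    t  = fst f
    l  = snd f
    l₁ = fst l
    l₂ = snd l
    z  = ⟪ fst l₂ , sucᵗ (snd l₂) ⟫

private
  step-at : ∀ p s {k f t l v K l₁ l₂} → π₁ s ≡ v → π₂ s ≡ suc k → π₁ k ≡ f → π₂ k ≡ K →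
    π₁ f ≡ t → π₂ f ≡ l → π₁ l ≡ l₁ → π₂ l ≡ l₂ → step p s ≡ dispatch p t l l₁ l₂ v K
  step-at p s refl eq refl refl refl refl refl refl rewrite eq = refl

step-push : ∀ p t l v K →
  step p (pair v (push (pair t l) K)) ≡ dispatch p t l (π₁ l) (π₂ l) v K
step-push p t l v K = step-at p (pair v (push (pair t l) K))
  (π₁-pair v (push (pair t l) K)) (π₂-pair v (push (pair t l) K))
  (π₁-pair (pair t l) K) (π₂-pair (pair t l) K) (π₁-pair t l) (π₂-pair t l) refl refl

step-push₂ : ∀ p t l₁ l₂ v K →
  step p (pair v (push (pair t (pair l₁ l₂)) K)) ≡ dispatch p t (pair l₁ l₂) l₁ l₂ v K
step-push₂ p t l₁ l₂ v K = step-at p (pair v (push (pair t (pair l₁ l₂)) K))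
  (π₁-pair v (push (pair t (pair l₁ l₂)) K)) (π₂-pair v (push (pair t (pair l₁ l₂)) K))
  (π₁-pair (pair t (pair l₁ l₂)) K) (π₂-pair (pair t (pair l₁ l₂)) K)
  (π₁-pair t (pair l₁ l₂)) (π₂-pair t (pair l₁ l₂)) (π₁-pair l₁ l₂) (π₂-pair l₁ l₂)

-- A structured copy of the machine, on which correctness is proved by pattern matching;
-- `step-encode` transfers it to numbers.
data Frame : Set where
  exec     : Code → Frame
  keep     : Code → ℕ → Frame
  pairWith : ℕ → Frame
  seek     : Code → ℕ → ℕ → Frame

State : Set
State = ℕ × List Frame

encodeFrame : Frame → ℕ
encodeFrame (exec e)     = encode e
encodeFrame (keep e x)   = pair 9 (pair (encode e) x)
encodeFrame (pairWith x) = pair 10 x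
encodeFrame (seek d x n) = pair 11 (pair (encode d) (pair x n))

encodeStack : List Frame → ℕ
encodeStack []      = 0
encodeStack (f ∷ K) = push (encodeFrame f) (encodeStack K)

encodeState : State → ℕ
encodeState (v , K) = pair v (encodeStack K)

stepPrec : Code → Code → ℕ → ℕ → List Frame → State
stepPrec d e x zero    K = x , exec d ∷ K
-- Once the recursive call has returned y, the two `pairWith` frames build (n , y) and then (x , (n
-- , y)), the input that `e` expects.
stepPrec d e x (suc n) K = pair x n , exec (precᶜ d e) ∷ pairWith n ∷ pairWith x ∷ exec e ∷ K

stepState : Baire → State → State
stepState p (v , [])                 = v , []
stepState p (v , exec zeroᶜ ∷ K)       = 0 , K
stepState p (v , exec succᶜ ∷ K)       = suc v , K
stepState p (v , exec leftᶜ ∷ K)       = π₁ v , K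
stepState p (v , exec rightᶜ ∷ K)      = π₂ v , K
stepState p (v , exec oracleᶜ ∷ K)     = p v , K
stepState p (v , exec (pairᶜ d e) ∷ K) = v , exec d ∷ keep e v ∷ K
stepState p (v , exec (compᶜ d e) ∷ K) = v , exec e ∷ exec d ∷ K
stepState p (v , exec (precᶜ d e) ∷ K) = stepPrec d e (π₁ v) (π₂ v) K
stepState p (v , exec (muᶜ d) ∷ K)     = pair v 0 , exec d ∷ seek d v 0 ∷ K
stepState p (v , keep e x ∷ K)         = x , exec e ∷ pairWith v ∷ K
stepState p (v , pairWith x ∷ K)       = pair x v , K
stepState p (zero  , seek d x n ∷ K)   = n , K
stepState p (suc _ , seek d x n ∷ K)   = pair x (suc n) , exec d ∷ seek d x (suc n) ∷ K

step-encode : ∀ p σ → step p (encodeState σ) ≡ encodeState (stepState p σ)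
step-encode p (v , []) = halt (pair v 0) (π₂-pair v 0)
  where
  halt : ∀ s → π₂ s ≡ 0 → step p s ≡ s
  halt s eq rewrite eq = refl
step-encode p (v , exec zeroᶜ ∷ K)       = step-push p 0 0 v (encodeStack K)
step-encode p (v , exec succᶜ ∷ K)       = step-push p 1 0 v (encodeStack K)
step-encode p (v , exec leftᶜ ∷ K)       = step-push p 2 0 v (encodeStack K)
step-encode p (v , exec rightᶜ ∷ K)      = step-push p 3 0 v (encodeStack K)
step-encode p (v , exec oracleᶜ ∷ K)     = step-push p 4 0 v (encodeStack K)
step-encode p (v , exec (pairᶜ d e) ∷ K) = step-push₂ p 5 (encode d) (encode e) v (encodeStack K)
step-encode p (v , exec (compᶜ d e) ∷ K) = step-push₂ p 6 (encode d) (encode e) v (encodeStack K)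
step-encode p (v , exec (precᶜ d e) ∷ K) =
  trans (step-push₂ p 7 (encode d) (encode e) v (encodeStack K)) (branch (π₂ v))
  where
  branch : ∀ k → ifz k
      (pair (π₁ v) (push (encode d) (encodeStack K)))
      (pair (pair (π₁ v) (pred k)) (push (encode (precᶜ d e))
        (push (pair 10 (pred k)) (push (pair 10 (π₁ v)) (push (encode e) (encodeStack K))))))
    ≡ encodeState (stepPrec d e (π₁ v) k K)
  branch zero    = refl
  branch (suc k) = refl
step-encode p (v , exec (muᶜ d) ∷ K)     = step-push p 8 (encode d) v (encodeStack K)
step-encode p (v , keep e x ∷ K)         = step-push₂ p 9 (encode e) x v (encodeStack K)
step-encode p (v , pairWith x ∷ K)       = step-push p 10 x v (encodeStack K)
step-encode p (zero  , seek d x n ∷ K)   =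
  trans (step-push₂ p 11 (encode d) (pair x n) 0 (encodeStack K))
    (cong (λ k → pair k (encodeStack K)) (π₂-pair x n))
step-encode p (suc y , seek d x n ∷ K)   =
  trans (step-push₂ p 11 (encode d) (pair x n) (suc y) (encodeStack K))
    (cong₂ (λ w k → pair (pair w (suc k))
        (push (encode d) (push (pair 11 (pair (encode d) (pair w (suc k)))) (encodeStack K))))
      (π₁-pair x n) (π₂-pair x n))

module _ (p : Baire) where

  run : ℕ → State → State
  run zero    σ = σ
  run (suc t) σ = run t (stepState p σ)

  run-+ : ∀ t u σ → run (t + u) σ ≡ run u (run t σ)
  run-+ zero    u σ = refl
  run-+ (suc t) u σ = run-+ t u (stepState p σ)

  run-halted : ∀ t v → run t (v , []) ≡ (v , [])
  run-halted zero    v = refl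
  run-halted (suc t) v = run-halted t v

  -- `natrec` adds a step at the end of a run and `run` at its beginning; `run-+` reconciles the
  -- two.
  run-encode : ∀ t σ → natrec (encodeState σ) (λ _ → step p) t ≡ encodeState (run t σ)
  run-encode zero    σ = refl
  run-encode (suc t) σ = trans (cong (step p) (run-encode t σ)) (trans (step-encode p (run t σ))
    (cong encodeState (trans (sym (run-+ t 1 σ)) (cong (λ u → run u σ) (+-comm t 1)))))

  Reaches : State → State → Set
  Reaches σ σ′ = ∃[ t ] run t σ ≡ σ′

  infixr 2 _▹_

  _▹_ : ∀ {σ σ₁ σ₂} → Reaches σ σ₁ → Reaches σ₁ σ₂ → Reaches σ σ₂
  _▹_ {σ} (t , refl) (u , eq) = t + u , trans (run-+ t u σ) eq

  stop : ∀ {σ} → Reaches σ σ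
  stop = 0 , refl

  move : ∀ {σ} → Reaches σ (stepState p σ)
  move = 1 , refl

  -- `K` is arbitrary because a subcomputation runs with its continuation still on the stack.
  reaches : ∀ {e x y} → p ⊢ e [ x ]⇓ y → ∀ K → Reaches (x , exec e ∷ K) (y , K)

  reaches-mu : ∀ {d x n} → (∀ m → m < n → ∃[ y ] p ⊢ d [ pair x m ]⇓ suc y) → ∀ m → m ≤ n → ∀ K →
    Reaches (pair x 0 , exec d ∷ seek d x 0 ∷ K) (pair x m , exec d ∷ seek d x m ∷ K)

  reaches zero⇓   K = move
  reaches succ⇓   K = move
  reaches left⇓   K = move
  reaches right⇓  K = move
  reaches oracle⇓ K = move
  reaches {pairᶜ d e} {x} (pair⇓ {y = y} s t) K =
    move ▹ reaches s (keep e x ∷ K) ▹ move ▹ reaches t (pairWith y ∷ K) ▹ move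
  reaches {compᶜ d e} (comp⇓ s t) K = move ▹ reaches s (exec d ∷ K) ▹ reaches t K
  reaches {precᶜ d e} {x} (prec⇓₀ eq s) K =
    (1 , cong (λ k → stepPrec d e (π₁ x) k K) eq) ▹ reaches s K
  reaches {precᶜ d e} {x} (prec⇓₊ {n = n} eq s t) K =
    (1 , cong (λ k → stepPrec d e (π₁ x) k K) eq) ▹
    reaches s (pairWith n ∷ pairWith (π₁ x) ∷ exec e ∷ K) ▹ move ▹ move ▹ reaches t K
  reaches {muᶜ d} {x} (mu⇓ {n = n} below s) K =
    move ▹ reaches-mu below n ≤-refl K ▹ reaches s (seek d x n ∷ K) ▹ move

  reaches-mu below zero    _   K = stop
  reaches-mu {d} {x} below (suc m) m<n K =
    reaches-mu below m (<⇒≤ m<n) K ▹ reaches (proj₂ (below m m<n)) (seek d x m ∷ K) ▹ move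

  resume : ∀ t {w f K v} → run t (w , f ∷ K) ≡ (v , []) →
    ∃[ t′ ] t′ < t × run t′ (stepState p (w , f ∷ K)) ≡ (v , [])
  resume (suc t) eq = t , ≤-refl , eq

  Returns : ℕ → Code → ℕ → List Frame → ℕ → Set
  Returns t e x K v = ∃[ y ] ∃[ t′ ] t′ < t × p ⊢ e [ x ]⇓ y × run t′ (y , K) ≡ (v , [])

  -- A run that empties the stack must first dispose of the top frame. The induction is on the
  -- remaining time rather than on the code, since `precᶜ` restarts with the same code and `muᶜ`
  -- repeats its body.
  returns : ∀ t → Acc _<_ t → ∀ e x K {v} → run t (x , exec e ∷ K) ≡ (v , []) → Returns t e x K v

  returns-mu : ∀ t → Acc _<_ t → ∀ d x n K {v} → (∀ m → m < n → ∃[ y ] p ⊢ d [ pair x m ]⇓ suc y) →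
    run t (pair x n , exec d ∷ seek d x n ∷ K) ≡ (v , []) → Returns t (muᶜ d) x K v

  returns (suc t) _ zeroᶜ   x K r = 0    , t , ≤-refl , zero⇓   , r
  returns (suc t) _ succᶜ   x K r = suc x , t , ≤-refl , succ⇓   , r
  returns (suc t) _ leftᶜ   x K r = π₁ x , t , ≤-refl , left⇓   , r
  returns (suc t) _ rightᶜ  x K r = π₂ x , t , ≤-refl , right⇓  , r
  returns (suc t) _ oracleᶜ x K r = p x  , t , ≤-refl , oracle⇓ , r
  returns (suc t) (acc rs) (pairᶜ d e) x K r =
    let y , t₁ , lt₁ , s , r₁ = returns t (rs ≤-refl) d x (keep e x ∷ K) r
        t₂ , lt₂ , r₂         = resume t₁ r₁
        lt₂                   = <-trans lt₂ (m<n⇒m<1+n lt₁)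
        z , t₃ , lt₃ , u , r₃ = returns t₂ (rs lt₂) e x (pairWith y ∷ K) r₂
        t₄ , lt₄ , r₄         = resume t₃ r₃
    in pair y z , t₄ , <-trans lt₄ (<-trans lt₃ lt₂) , pair⇓ s u , r₄
  returns (suc t) (acc rs) (compᶜ d e) x K r =
    let y , t₁ , lt₁ , s , r₁ = returns t (rs ≤-refl) e x (exec d ∷ K) r
        lt₁                   = m<n⇒m<1+n lt₁
        z , t₂ , lt₂ , u , r₂ = returns t₁ (rs lt₁) d y K r₁
    in z , t₂ , <-trans lt₂ lt₁ , comp⇓ s u , r₂
  returns (suc t) (acc rs) (precᶜ d e) x K r with π₂ x in eq
  ... | zero =
    let y , t₁ , lt₁ , s , r₁ = returns t (rs ≤-refl) d (π₁ x) K r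
    in y , t₁ , m<n⇒m<1+n lt₁ , prec⇓₀ eq s , r₁
  ... | suc n =
    let y , t₁ , lt₁ , s , r₁ = returns t (rs ≤-refl) (precᶜ d e) (pair (π₁ x) n) _ r
        t₂ , lt₂ , r₂         = resume t₁ r₁
        t₃ , lt₃ , r₃         = resume t₂ r₂
        lt₃                   = <-trans lt₃ (<-trans lt₂ (m<n⇒m<1+n lt₁))
        z , t₄ , lt₄ , u , r₄ = returns t₃ (rs lt₃) e (pair (π₁ x) (pair n y)) K r₃
    in z , t₄ , <-trans lt₄ lt₃ , prec⇓₊ eq s u , r₄
  returns (suc t) (acc rs) (muᶜ d) x K r =
    let n , t₁ , lt₁ , s = returns-mu t (rs ≤-refl) d x 0 K (λ _ ()) r
    in n , t₁ , m<n⇒m<1+n lt₁ , s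

  returns-mu t (acc rs) d x n K below r with returns t (acc rs) d (pair x n) (seek d x n ∷ K) r
  ... | zero , t₁ , lt₁ , s , r₁ =
    let t₂ , lt₂ , r₂ = resume t₁ r₁
    in n , t₂ , <-trans lt₂ lt₁ , mu⇓ below s , r₂
  ... | suc y , t₁ , lt₁ , s , r₁ =
    let t₂ , lt₂ , r₂    = resume t₁ r₁
        lt₂              = <-trans lt₂ lt₁
        m , t₃ , lt₃ , u = returns-mu t₂ (rs lt₂) d x (suc n) K below′ r₂
    in m , t₃ , <-trans lt₃ lt₂ , u
    where
    below′ : ∀ m → m < suc n → ∃[ y ] p ⊢ d [ pair x m ]⇓ suc y
    below′ m (s≤s m≤n) with m≤n⇒m<n∨m≡n m≤n
    ... | inj₁ m<n  = below m m<n
    ... | inj₂ refl = y , s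

-- Staged evaluation and the universal program.

opaque

  stage : Baire → ℕ → ℕ → ℕ → ℕ
  stage p c x t = natrec (pair x (push c 0)) (λ _ → step p) t

  stage-natrec : ∀ p c x t → natrec (pair x (push c 0)) (λ _ → step p) t ≡ stage p c x t
  stage-natrec p c x t = refl

  halts : ∀ {p e c x y} → encode e ≡ c → p ⊢ e [ x ]⇓ y → ∃[ t ] π₂ (stage p c x t) ≡ 0
  halts {p} {e} {_} {x} {y} refl s = let t , eq = reaches p s [] in
    t , trans (cong π₂ (trans (run-encode p t (x , exec e ∷ [])) (cong encodeState eq))) (π₂-pair y 0)

  -- An empty stack at stage t lets `returns` recover a derivation; by `run-halted` the time left
  -- over after it does not change the output.
  halted : ∀ p e {c} → encode e ≡ c → ∀ x t → π₂ (stage p c x t) ≡ 0 → p ⊢ e [ x ]⇓ π₁ (stage p c x t)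
  halted p e refl x t eq with run p t (x , exec e ∷ []) in r | run-encode p t (x , exec e ∷ [])
  ... | v , f ∷ K | stage≡ =
    contradiction (trans (sym (π₂-pair v (encodeStack (f ∷ K)))) (trans (cong π₂ (sym stage≡)) eq)) λ ()
  ... | v , [] | stage≡ with returns p t (<-wellFounded t) e x [] r
  ...   | y , t′ , _ , s , r′ =
    subst (p ⊢ e [ x ]⇓_)
      (trans (cong proj₁ (trans (sym (run-halted p t′ y)) r′))
           (sym (trans (cong π₁ stage≡) (π₁-pair v 0))))
      s

module _ {D : Set a} {o : D → Baire} where

  stageᵗ : Term o (suc n) → Term o n → Term o n → Term o n → Term o n
  stageᵗ Q C X T = ext (rec T ⟪ X , pushᵗ C (const 0) ⟫ (weaken (stepᵗ Q)))
    (λ d v → stage (λ k → val Q d (k ∷ v)) (val C d v) (val X d v) (val T d v))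
    λ d v → stage-natrec (λ k → val Q d (k ∷ v)) (val C d v) (val X d v) (val T d v)

  -- C computes the number of a code, which is run on X with oracle Q.
  universal : (Q : Term o (suc n)) (C X : Term o n) (e : D → Vec ℕ n → Code) (b : D → Vec ℕ n → ℕ) →
    (∀ d v → encode (e d v) ≡ val C d v) →
    (∀ d v → (λ k → val Q d (k ∷ v)) ⊢ e d v [ val X d v ]⇓ b d v) → Term o n
  universal {n} Q C X e b e≡C runs =
    ext (Let (search B zero-exists) (fst state)) b
      λ d v → ⇓-functional
        (halted _ (e d v) (e≡C d v) (val X d v) (val (search B zero-exists) d v) (found B zero-exists d v))
        (runs d v)
    where
    state B : Term o (suc n)
    state = stageᵗ (under Q) (weaken C) (weaken X) #0
    B     = snd state

    zero-exists : ∀ d v → ∃[ m ] val B d (m ∷ v) ≡ 0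
    zero-exists d v = halts (e≡C d v) (runs d v)

  -- Composition of realisers: a fixed code is simulated on the oracle computed by `Q`.
  via : (e : Code) (Q : Term o (suc n)) (b : D → Vec ℕ n → Baire) →
    (∀ d v → ⟦ e ⟧ (λ k → val Q d (k ∷ v)) (b d v)) → Term o n → Term o n
  via e Q b runs X = universal Q (const (encode e)) X (λ _ _ → e) (λ d v → b d v (val X d v))
    (λ _ _ → refl) (λ d v → runs d v (val X d v))

module _ {D : Set a} {o : D → Baire} where

  notᵗ : Term o n → Term o n
  notᵗ T = caseᵗ T (const 1) (const 0)

  private
    not-positive : ∀ {m} → m ≢ 0 → ifz m 1 0 ≡ 0
    not-positive {zero}  m≢0 = contradiction refl m≢0
    not-positive {suc m} _   = refl

    positive-not : ∀ {m} → ifz m 1 0 ≡ 0 → m ≢ 0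
    positive-not () refl

  module SearchPositive (T : Term o (suc n)) (exists : ∀ d v → ∃[ m ] val T d (m ∷ v) ≢ 0) where

    private
      zero-exists : ∀ d v → ∃[ m ] val (notᵗ T) d (m ∷ v) ≡ 0
      zero-exists d v = proj₁ (exists d v) , not-positive (proj₂ (exists d v))

    searchPositive : Term o n
    searchPositive = search (notᵗ T) zero-exists

    foundPositive : ∀ d v → val T d (val searchPositive d v ∷ v) ≢ 0
    foundPositive d v = positive-not (found (notᵗ T) zero-exists d v)

  open SearchPositive public

  private
    muBody : Term o 2 → Code
    muBody T = compᶜ (code (notᵗ T)) (pairᶜ rightᶜ (pairᶜ leftᶜ zeroᶜ))

    muBody⇓ : ∀ T d x m {y} → val (notᵗ T) d (m ∷ x ∷ []) ≡ y → o d ⊢ muBody T [ pair x m ]⇓ y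
    muBody⇓ T d x m refl =
      comp⇓ (pair⇓ (right-pair⇓ x m) (pair⇓ (left-pair⇓ x m) zero⇓)) (computes (notᵗ T) d (m ∷ x ∷ []))

  halting : Term o 2 → Code
  halting T = muᶜ (muBody T)

  -- Here the search may diverge: its domain is the set to be enumerated, as in
  -- `ComputablyEnumerable`.
  halting⇔ : ∀ (T : Term o 2) d x →
    (∃[ m ] val T d (m ∷ x ∷ []) ≢ 0) ⇔ (∃[ z ] o d ⊢ halting T [ x ]⇓ z)
  halting⇔ T d x = mk⇔ to from
    where
    to : _ → _
    to (m , m-positive) =
      let z , z-zero , below = least-zero (λ m → val (notᵗ T) d (m ∷ x ∷ [])) m (not-positive m-positive)
      in z , mu⇓ (λ j j<z → let y , eq = below j j<z in y , muBody⇓ T d x j eq) (muBody⇓ T d x z z-zero)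

    from : _ → _
    from (z , mu⇓ _ s) = z , positive-not (⇓-functional (muBody⇓ T d x z refl) s)

-- Continuity of computations in the oracle.

Agree : ℕ → Baire → Baire → Set
Agree K p q = ∀ {j} → j < K → p j ≡ q j

Agree-mono : ∀ {K L p q} → K ≤ L → Agree L p q → Agree K p q
Agree-mono K≤L agree j<K = agree (<-≤-trans j<K K≤L)

⟨,⟩-agree : ∀ K {p p′ q q′} → Agree K p p′ → Agree K q q′ → Agree K ⟨ p , q ⟩ ⟨ p′ , q′ ⟩
⟨,⟩-agree (suc K) a b {zero}  _         = a (s≤s z≤n)
⟨,⟩-agree (suc K) a b {suc j} (s≤s j<K) =
  ⟨,⟩-agree K (Agree-mono (n≤1+n K) b) (λ i<K → a (s≤s i<K)) j<K

-- A derivation queries the oracle finitely often, even under `mu⇓`, whose premises range over m <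
-- n; `K` exceeds all queries.
use-principle : ∀ {p e x y} → p ⊢ e [ x ]⇓ y → ∃[ K ] ∀ {q} → Agree K p q → q ⊢ e [ x ]⇓ y

private
  use-principle-mu : ∀ {p d x} n → (∀ m → m < n → ∃[ y ] p ⊢ d [ pair x m ]⇓ suc y) →
    ∃[ K ] ∀ {q} → Agree K p q → ∀ m → m < n → ∃[ y ] q ⊢ d [ pair x m ]⇓ suc y

use-principle zero⇓  = 0 , λ _ → zero⇓
use-principle succ⇓  = 0 , λ _ → succ⇓
use-principle left⇓  = 0 , λ _ → left⇓
use-principle right⇓ = 0 , λ _ → right⇓
use-principle (oracle⇓ {x}) = suc x , λ {q} agree → subst (q ⊢ oracleᶜ [ x ]⇓_) (sym (agree ≤-refl)) oracle⇓
use-principle (pair⇓ s t) =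
  let K , f = use-principle s
      L , g = use-principle t
  in K ⊔ L , λ agree → pair⇓ (f (Agree-mono (m≤m⊔n K L) agree)) (g (Agree-mono (m≤n⊔m K L) agree))
use-principle (comp⇓ s t) =
  let K , f = use-principle s
      L , g = use-principle t
  in K ⊔ L , λ agree → comp⇓ (f (Agree-mono (m≤m⊔n K L) agree)) (g (Agree-mono (m≤n⊔m K L) agree))
use-principle (prec⇓₀ eq s) = let K , f = use-principle s in K , λ agree → prec⇓₀ eq (f agree)
use-principle (prec⇓₊ eq s t) =
  let K , f = use-principle s
      L , g = use-principle t
  in K ⊔ L , λ agree → prec⇓₊ eq (f (Agree-mono (m≤m⊔n K L) agree)) (g (Agree-mono (m≤n⊔m K L) agree))
use-principle (mu⇓ {n = n} below s) =
  let K , f = use-principle-mu n below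
      L , g = use-principle s
  in K ⊔ L , λ agree → mu⇓ (f (Agree-mono (m≤m⊔n K L) agree)) (g (Agree-mono (m≤n⊔m K L) agree))

use-principle-mu zero below = 0 , λ _ _ ()
use-principle-mu {d = d} {x} (suc n) below =
  let y , s = below n ≤-refl
      K , f = use-principle-mu n (λ m m<n → below m (m<n⇒m<1+n m<n))
      L , g = use-principle s
  in K ⊔ L , λ agree m m<1+n →
       extend (f (Agree-mono (m≤m⊔n K L) agree)) (y , g (Agree-mono (m≤n⊔m K L) agree)) m m<1+n
  where
  extend : ∀ {P : ℕ → Set} → (∀ m → m < n → P m) → P n → ∀ m → m < suc n → P m
  extend f p m (s≤s m≤n) with m≤n⇒m<n∨m≡n m≤n
  ... | inj₁ m<n  = f m m<n
  ... | inj₂ refl = p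

-- Open sets and semidecidable predicates.

Positive : Baire → Set
Positive b = ∃[ k ] b k ≢ 0

module _ (X : RepresentedSpace c ℓ r) where

  Name : Set _
  Name = Σ[ p ∈ Baire ] Σ[ x ∈ Carrier X ] _⊩_ X p x

  named : Name → Carrier X
  named (_ , x , _) = x

  named⊩ : ∀ d → _⊩_ X (proj₁ d) (named d)
  named⊩ (_ , _ , p⊩x) = p⊩x

  Semidecidable : Pred (Carrier X) ℓᵖ → Set _
  Semidecidable P = ∃[ e ] ∀ {p x} → _⊩_ X p x → ∃[ b ] ⟦ e ⟧ p b × (P x ⇔ Positive b)

  -- The parameter is a constant oracle on the left, where `CodesRealiser` puts the tail of a name.
  -- One code thus serves all members, as in the s-m-n theorem.
  SemidecidableFamily : (ℕ → Pred (Carrier X) ℓᵖ) → Set _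
  SemidecidableFamily P =
    ∃[ e ] ∀ m {p x} → _⊩_ X p x → ∃[ b ] ⟦ e ⟧ ⟨ (λ _ → m) , p ⟩ b × (P m x ⇔ Positive b)

  SemidecidableKernel : ∀ {Y : Set ℓᵖ} {ℓ′} → (Y → Y → Set ℓ′) → (Carrier X → Y) → Set _
  SemidecidableKernel _~_ f =
    ∃[ e ] ∀ {p q x y} → _⊩_ X p x → _⊩_ X q y → ∃[ b ] ⟦ e ⟧ ⟨ p , q ⟩ b × ((f x ~ f y) ⇔ Positive b)

module Classical (em : ∀ {a} → ExcludedMiddle a) where

  -- `𝕊` defines names of `⊤` by a negation; excluded middle turns it into a nonzero entry, for
  -- which a program can search.
  names⊤⇔ : ∀ {b s} → _⊩_ 𝕊 b s → (s ≡ ⊤) ⇔ Positive b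
  names⊤⇔ {b} {⊤} ¬zero = mk⇔ to (λ _ → refl)
    where
    to : _ → Positive b
    to _ with em {P = Positive b}
    ... | yes pos = pos
    ... | no ¬pos = contradiction (λ k → decidable-stable (b k ≟ 0) (λ bk≢0 → ¬pos (k , bk≢0))) ¬zero
  names⊤⇔ {b} {⊥} all-zero = mk⇔ (λ ()) (λ { (k , bk≢0) → contradiction (all-zero k) bk≢0 })

  -- Characteristic functions are decided classically; their computational content lies in their
  -- names alone.
  truth : Set ℓᵖ → Sierpinski
  truth P with em {P = P}
  ... | yes _ = ⊤
  ... | no  _ = ⊥

  truth⇔ : ∀ (P : Set ℓᵖ) → (truth P ≡ ⊤) ⇔ P
  truth⇔ P with em {P = P}
  ... | yes p = mk⇔ (λ _ → p) (λ _ → refl)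
  ... | no ¬p = mk⇔ (λ ()) (λ p → contradiction p ¬p)

  truth-cong : ∀ {P Q : Set ℓᵖ} → P ⇔ Q → truth P ≡ truth Q
  truth-cong {P = P} {Q} eq with em {P = P} | em {P = Q}
  ... | yes _ | yes _ = refl
  ... | no  _ | no  _ = refl
  ... | yes p | no ¬q = contradiction (Equivalence.to eq p) ¬q
  ... | no ¬p | yes q = contradiction (Equivalence.from eq q) ¬p

  truth-name : ∀ {P : Set ℓᵖ} {b} → P ⇔ Positive b → _⊩_ 𝕊 b (truth P)
  truth-name {P = P} {b} eq with em {P = P}
  ... | yes p = λ all-zero → let k , bk≢0 = Equivalence.to eq p in bk≢0 (all-zero k)
  ... | no ¬p = λ k → decidable-stable (b k ≟ 0) (λ bk≢0 → ¬p (Equivalence.from eq (k , bk≢0)))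

  module _ (X : RepresentedSpace c ℓ r) where
    private module X = RepresentedSpace X
    private module SX = Setoid X.points

    open⇒semidecidable : ∀ {P : Pred X.Carrier ℓᵖ} → ComputablyOpen X P → Semidecidable X P
    open⇒semidecidable {P = P} (U , U⇔P , u , (e , _ , real) , (c , c⇓)) =
      program T , λ {p} {x} p⊩x → sequence T (p , x , p⊩x) , program⇓ T (p , x , p⊩x) , mk⇔
        (λ Px → Equivalence.to (names⊤⇔ (proj₂ (proj₂ (real p⊩x)))) (Equivalence.from (U⇔P x) Px))
        (λ pos → Equivalence.to (U⇔P x) (Equivalence.from (names⊤⇔ (proj₂ (proj₂ (real p⊩x)))) pos))
      where
      o : Name X → Baire
      o = proj₁
      T : Term o 1
      -- `sucᵗ #0` passes to the tail of `u`, since `u 0` is the index of the code `e` already in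
      -- hand.
      T = via e (interleave (via c (const 0) (λ _ _ → u) (λ _ _ → c⇓) (sucᵗ #0)) (oracle #0))
            (λ { (_ , _ , p⊩x) _ → proj₁ (real p⊩x) })
            (λ { (_ , _ , p⊩x) _ → proj₁ (proj₂ (real p⊩x)) }) #0

    module Sections {P : ℕ → Pred X.Carrier ℓᵖ} (semi : SemidecidableFamily X P) where

      private e = proj₁ semi

      sectionName : ℕ → Baire
      sectionName m j = ifz j (encode e) m

      private
        -- `P m` is extensional because equal points share a name, and on that name the test has
        -- only one run.
        section-resp : ∀ m {x y} → x X.≈ y → P m x → P m y
        section-resp m {x} {y} x≈y Pmx =
          let p , p⊩x = X.surjective x
              b , run , ⇔b = proj₂ semi m p⊩x
              b′ , run′ , ⇔b′ = proj₂ semi m (X.⊩-resp (λ _ → refl) x≈y p⊩x)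
              k , bk≢0 = Equivalence.to ⇔b Pmx
          in Equivalence.from ⇔b′ (k , λ b′k≡0 → bk≢0 (trans (⇓-functional (run k) (run′ k)) b′k≡0))

        characteristic : ℕ → Map X 𝕊
        characteristic m = record
          { to   = λ x → truth (P m x)
          ; cong = λ x≈y → truth-cong (mk⇔ (section-resp m x≈y) (section-resp m (SX.sym x≈y)))
          }

        codes : ∀ m → CodesRealiser X 𝕊 (sectionName m) (characteristic m)
        codes m = e , refl , λ p⊩x → let b , run , ⇔b = proj₂ semi m p⊩x in b , run , truth-name ⇔b

      section : ℕ → Carrier (𝒪 X)
      section m = characteristic m , sectionName m , codes m

      section⊩ : ∀ m → _⊩_ (𝒪 X) (sectionName m) (section m)
      section⊩ = codes

      ∈-section : ∀ m x → (_∈_ X x (section m)) ⇔ P m x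
      ∈-section m x = truth⇔ (P m x)

      module _ {D : Set a} {o : D → Baire} where

        sectionᵗ : Term o n → Term o n → Term o n
        sectionᵗ M J = caseᵗ J (const (encode e)) M

      section-computable : ∀ m → ComputablePoint (𝒪 X) (section m)
      section-computable m = sectionName m , section⊩ m , program T , program⇓ T noOracle
        where
        T : Term (λ (p : Baire) → p) 1
        T = sectionᵗ (const m) #0

    ParamName : Set _
    ParamName = ℕ × Name X

    paramOracle : ParamName → Baire
    paramOracle (m , p , _) = ⟨ (λ _ → m) , p ⟩

    pointᵗ : Term paramOracle n → Term paramOracle n
    pointᵗ J = ext (oracle (sucᵗ (double J))) (λ { d@(m , p , _) v → p (val J d v) })
      λ { d@(m , p , _) v → odds-⟨,⟩ (λ _ → m) p (val J d v) }

    semidecidable⇒open : ∀ {P : Pred X.Carrier ℓᵖ} → Semidecidable X P → ComputablyOpen X P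
    semidecidable⇒open {P = P} (e , semi) =
      -- A single predicate is a constant family, and the parameter 0 is arbitrary.
      section 0 , ∈-section 0 , section-computable 0
      where
      T : Term paramOracle 1
      T = via e (pointᵗ #0) (λ { (_ , _ , _ , p⊩x) _ → proj₁ (semi p⊩x) })
            (λ { (_ , _ , _ , p⊩x) _ → proj₁ (proj₂ (semi p⊩x)) }) #0

      constant : SemidecidableFamily X (λ _ → P)
      constant = program T , λ m {p} {x} p⊩x →
        sequence T (m , p , x , p⊩x) , program⇓ T (m , p , x , p⊩x) , proj₂ (proj₂ (semi p⊩x))

      open Sections {P = λ _ → P} constant

    module Apply {D : Set a} {o : D → Baire} (N Q : Term o (suc n))
      (U : D → Vec ℕ n → Carrier (𝒪 X)) (x : D → Vec ℕ n → X.Carrier)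
      (N⊩ : ∀ d v → _⊩_ (𝒪 X) (λ j → val N d (j ∷ v)) (U d v))
      (Q⊩ : ∀ d v → (λ j → val Q d (j ∷ v)) X.⊩ x d v) where

      private
        result : ∀ d v → _
        result d v = proj₂ (proj₂ (N⊩ d v)) (Q⊩ d v)

      truthValue : D → Vec ℕ n → Baire
      truthValue d v = proj₁ (result d v)

      ∈⇔ : ∀ d v → (_∈_ X (x d v) (U d v)) ⇔ Positive (truthValue d v)
      ∈⇔ d v = names⊤⇔ (proj₂ (proj₂ (result d v)))

      apply : Term o n → Term o n
      -- The name computed by `N` is split into its tail, used as oracle, and its entry at 0, used
      -- as program. That program varies with the data, so `via` does not apply.
      apply K = universal (interleave (N at sucᵗ #0) Q) (Let (const 0) N) K
        (λ d v → proj₁ (N⊩ d v)) (λ d v → truthValue d v (val K d v))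
        (λ d v → proj₁ (proj₂ (N⊩ d v))) (λ d v → proj₁ (proj₂ (result d v)) (val K d v))

  -- At k = (m , j), stage j of the test whether x m lies in U is run.
  module Dovetail (X : RepresentedSpace c ℓ r) {D : Set a} {o : D → Baire}
    (N : Term o 1) (U : D → Carrier (𝒪 X)) (N⊩ : ∀ d → _⊩_ (𝒪 X) (sequence N d) (U d))
    (x : ℕ → Carrier X) (name : ℕ → Baire) (name⊩ : ∀ m → _⊩_ X (name m) (x m))
    (Q : Term o 2) (Q≡ : ∀ d j k → val Q d (j ∷ k ∷ []) ≡ name (π₁ k) j) where

    private
      nameAt : D → Vec ℕ 2 → ℕ
      nameAt _ (j ∷ k ∷ []) = name (π₁ k) j

      nameᵗ : Term o 2
      nameᵗ = ext Q nameAt λ { d (j ∷ k ∷ []) → Q≡ d j k }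

      point : D → Vec ℕ 1 → Carrier X
      point _ (k ∷ []) = x (π₁ k)

      under⊩ : ∀ d v → _⊩_ (𝒪 X) (λ j → val (under N) d (j ∷ v)) (U d)
      under⊩ d (_ ∷ []) = N⊩ d

      nameᵗ⊩ : ∀ d v → _⊩_ X (λ j → val nameᵗ d (j ∷ v)) (point d v)
      nameᵗ⊩ _ (k ∷ []) = name⊩ (π₁ k)

      open Apply X {n = 1} {o = o} (under N) nameᵗ (λ d _ → U d) point under⊩ nameᵗ⊩

    hits : Term o 1
    hits = apply (snd #0)

    hits-sound : ∀ d k → sequence hits d k ≢ 0 → _∈_ X (x (π₁ k)) (U d)
    hits-sound d k positive = Equivalence.from (∈⇔ d (k ∷ [])) (π₂ k , positive)

    hits-complete : ∀ d m → _∈_ X (x m) (U d) → Positive (sequence hits d)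
    hits-complete d m xm∈U =
      -- `pair m 0` merely addresses the point `x m`; the stage `j` obtained there gives the actual
      -- hit `pair m j`.
      let j , positive = subst (Positive ∘ value) (π₁-pair m 0)
            (Equivalence.to (∈⇔ d (pair m 0 ∷ []))
              (subst (λ i → _∈_ X (x i) (U d)) (sym (π₁-pair m 0)) xm∈U))
      in pair m j , subst₂ (λ i j → value i j ≢ 0) (sym (π₁-pair m j)) (sym (π₂-pair m j)) positive
      where
      value : ℕ → Baire
      value i = proj₁ (proj₂ (proj₂ (N⊩ d)) (name⊩ i))

  -- Semidecidable equality.

  module _ (X : RepresentedSpace c ℓ r) where
    private module X = RepresentedSpace X
    private module SX = Setoid X.points

    opaque

      kernel⇒discrete : SemidecidableKernel X X._≈_ (λ x → x) → ComputablyDiscrete X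
      kernel⇒discrete (e , kernel) = semidecidable⇒open (X ×ʳ X) (program T , λ {p} {xy} p⊩xy →
        sequence T (p , xy , p⊩xy) , program⇓ T (p , xy , p⊩xy) ,
        proj₂ (proj₂ (kernel (proj₁ p⊩xy) (proj₂ p⊩xy))))
        where
        o : Name (X ×ʳ X) → Baire
        o = proj₁
        T : Term o 1
        T = via e (interleave (oracle (double #0)) (oracle (sucᵗ (double #0))))
              (λ { (_ , _ , p⊩x , p⊩y) _ → proj₁ (kernel p⊩x p⊩y) })
              (λ { (_ , _ , p⊩x , p⊩y) _ → proj₁ (proj₂ (kernel p⊩x p⊩y)) }) #0

      discrete⇒kernel : ComputablyDiscrete X → SemidecidableKernel X X._≈_ (λ x → x)
      discrete⇒kernel discrete =
        let e , semi = open⇒semidecidable (X ×ʳ X) discrete in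
        e , λ {p} {q} p⊩x q⊩y → semi
          ( X.⊩-resp (λ n → sym (evens-⟨,⟩ p q n)) SX.refl p⊩x
          , X.⊩-resp (λ n → sym (odds-⟨,⟩ p q n)) SX.refl q⊩y )

    module _ (Z : RepresentedSpace c′ ℓ′ r′) where
      private module Z = RepresentedSpace Z

      PairName : Set _
      PairName = Name Z × Name Z

      pairOracle : PairName → Baire
      pairOracle ((p , _) , (q , _)) = ⟨ p , q ⟩

      leftNameᵗ rightNameᵗ : Term pairOracle n → Term pairOracle n
      leftNameᵗ J = ext (oracle (double J)) (λ { ((p , _) , (q , _)) v → p (val J _ v) })
        λ { d@((p , _) , (q , _)) v → evens-⟨,⟩ p q (val J d v) }
      rightNameᵗ J = ext (oracle (sucᵗ (double J))) (λ { ((p , _) , (q , _)) v → q (val J _ v) })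
        λ { d@((p , _) , (q , _)) v → odds-⟨,⟩ p q (val J d v) }

      Realised : (Z.Carrier → X.Carrier) → Set _
      Realised f = ∃[ e ] ∀ {p z} → p Z.⊩ z → ∃[ q ] ⟦ e ⟧ p q × q X.⊩ f z

      opaque

        -- Carries the equality test of `X` over to other kinds of names: numbers, total names and
        -- listings of ideals.
        pullback-kernel : ∀ {f : Z.Carrier → X.Carrier} → Realised f →
          SemidecidableKernel X X._≈_ (λ x → x) → SemidecidableKernel Z X._≈_ f
        pullback-kernel {f = f} (d , real) (e , kernel) = program T , λ {p} {q} {x} {y} p⊩x q⊩y →
          let n = (p , x , p⊩x) , (q , y , q⊩y) in
          sequence T n , program⇓ T n , proj₂ (proj₂ (kernel (image⊩ p⊩x) (image⊩ q⊩y)))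
          where
          image⊩ : ∀ {p x} (p⊩x : p Z.⊩ x) → proj₁ (real p⊩x) X.⊩ f x
          image⊩ p⊩x = proj₂ (proj₂ (real p⊩x))

          T : Term pairOracle 1
          T = via e
            (interleave
              (via d (leftNameᵗ #0) (λ { ((_ , _ , p⊩x) , _) _ → proj₁ (real p⊩x) })
                (λ { ((_ , _ , p⊩x) , _) _ → proj₁ (proj₂ (real p⊩x)) }) #0)
              (via d (rightNameᵗ #0) (λ { (_ , (_ , _ , q⊩y)) _ → proj₁ (real q⊩y) })
                (λ { (_ , (_ , _ , q⊩y)) _ → proj₁ (proj₂ (real q⊩y)) }) #0))
            (λ { ((_ , _ , p⊩x) , (_ , _ , q⊩y)) _ → proj₁ (kernel (image⊩ p⊩x) (image⊩ q⊩y)) })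
            (λ { ((_ , _ , p⊩x) , (_ , _ , q⊩y)) _ → proj₁ (proj₂ (kernel (image⊩ p⊩x) (image⊩ q⊩y))) })
            #0

      -- The computation that accepts (z , z) reads only a finite part of its name.
      kernel⇒locally-constant : ∀ {f : Z.Carrier → X.Carrier} → SemidecidableKernel Z X._≈_ f →
        ∀ {p z} → p Z.⊩ z → ∃[ K ] ∀ {q z′} → q Z.⊩ z′ → Agree K p q → f z X.≈ f z′
      kernel⇒locally-constant (e , kernel) p⊩z =
        let b , run , ⇔b   = kernel p⊩z p⊩z
            k , bk≢0       = Equivalence.to ⇔b SX.refl
            K , local      = use-principle (run k)
        in K , λ q⊩z′ agree →
          let b′ , run′ , ⇔b′ = kernel p⊩z q⊩z′ in
          Equivalence.from ⇔b′ (k , λ b′k≡0 →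
            bk≢0 (trans (⇓-functional (local (⟨,⟩-agree K (λ _ → refl) agree)) (run′ k)) b′k≡0))

-- Consequences of a computable enumeration.

ifz-positive : ∀ {m} x y → m ≢ 0 → ifz m x y ≡ y
ifz-positive {zero}  x y m≢0 = contradiction refl m≢0
ifz-positive {suc m} x y _   = refl

module Enumerations (em : ∀ {a} → ExcludedMiddle a) where
  open Classical em

  module Enumerated (X : RepresentedSpace c ℓ r)
    (equality : SemidecidableKernel X (RepresentedSpace._≈_ X) (λ x → x))
    (enumeration : HasComputableEnumeration X) where

    private
      module X = RepresentedSpace X
      module SX = Setoid X.points
      module s = Surjection (proj₁ enumeration)

      s : ℕ → X.Carrier
      s = s.to

    pointName : ℕ → Baire
    pointName m = proj₁ (proj₂ (proj₂ enumeration) {p = λ _ → m} refl)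

    pointName⊩ : ∀ m → pointName m X.⊩ s m
    pointName⊩ m = proj₂ (proj₂ (proj₂ (proj₂ enumeration) {p = λ _ → m} refl))

    -- Chosen by surjectivity, with no program attached. The computed `indexᵗ` may depend on the
    -- name of the point and agrees with this choice only up to `R`.
    index : X.Carrier → ℕ
    index x = proj₁ (s.strictlySurjective x)

    s-index : ∀ x → s (index x) X.≈ x
    s-index x = proj₂ (s.strictlySurjective x)

    module _ {D : Set a} {o : D → Baire} where

      pointNameᵗ : Term o n → Term o n → Term o n
      pointNameᵗ M J = via (proj₁ (proj₂ enumeration)) (weaken M) (λ d v → pointName (val M d v))
        (λ d v → proj₁ (proj₂ (proj₂ (proj₂ enumeration) {p = λ _ → val M d v} refl))) J

      module Match (Q : Term o (suc n)) (x : D → Vec ℕ n → X.Carrier)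
        (Q⊩ : ∀ d v → (λ j → val Q d (j ∷ v)) X.⊩ x d v) where

        private
          compare : ∀ d v m → _
          compare d v m = proj₂ equality (pointName⊩ m) (Q⊩ d v)

        match : D → Vec ℕ n → ℕ → Baire
        match d v m = proj₁ (compare d v m)

        match⇔ : ∀ d v m → (s m X.≈ x d v) ⇔ Positive (match d v m)
        match⇔ d v m = proj₂ (proj₂ (compare d v m))

        matchᵗ : Term o n → Term o n → Term o n
        matchᵗ M J = via (proj₁ equality) (interleave (pointNameᵗ (weaken M) #0) Q)
          (λ d v → match d v (val M d v)) (λ d v → proj₁ (proj₂ (compare d v (val M d v)))) J

    -- The search variable codes a candidate and an entry of its equality test, since the test of a
    -- wrong candidate never rejects.
    module Index {D : Set a} {o : D → Baire} (Q : Term o (suc n)) (x : D → Vec ℕ n → X.Carrier)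
      (Q⊩ : ∀ d v → (λ j → val Q d (j ∷ v)) X.⊩ x d v) where

      private
        shifted : D → Vec ℕ (suc n) → X.Carrier
        shifted d (_ ∷ v) = x d v

        shifted⊩ : ∀ d v → (λ j → val (under Q) d (j ∷ v)) X.⊩ shifted d v
        shifted⊩ d (_ ∷ v) = Q⊩ d v

        open Match (under Q) shifted shifted⊩

        test : Term o (suc n)
        test = matchᵗ (fst #0) (snd #0)

        exists : ∀ d v → ∃[ m ] val test d (m ∷ v) ≢ 0
        exists d v =
          let k , positive = Equivalence.to (match⇔ d (0 ∷ v) (index (x d v))) (s-index (x d v))
              m = pair (index (x d v)) k
          in m , subst₂ (λ i j → match d (m ∷ v) i j ≢ 0)
                   (sym (π₁-pair (index (x d v)) k)) (sym (π₂-pair (index (x d v)) k)) positive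

      indexᵗ : Term o n
      indexᵗ = fst (searchPositive test exists)

      s-indexᵗ : ∀ d v → s (val indexᵗ d v) X.≈ x d v
      s-indexᵗ d v = Equivalence.from (match⇔ d (m ∷ v) (π₁ m)) (π₂ m , foundPositive test exists d v)
        where m = val (searchPositive test exists) d v

    -- `≈` lives at level `ℓ`, while `ℕ/` and `𝐈` take relations at level 0; `True` of a classical
    -- decision lowers the level.
    R : Rel ℕ 0ℓ
    R i j = True (em {P = s i X.≈ s j})

    R⇒≈ : ∀ {i j} → R i j → s i X.≈ s j
    R⇒≈ = toWitness

    ≈⇒R : ∀ {i j} → s i X.≈ s j → R i j
    ≈⇒R = fromWitness

    R-isEquivalence : IsEquivalence R
    R-isEquivalence = record
      { refl  = ≈⇒R SX.refl
      ; sym   = λ r → ≈⇒R (SX.sym (R⇒≈ r))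
      ; trans = λ q r → ≈⇒R (SX.trans (R⇒≈ q) (R⇒≈ r))
      }

    private
      Quotient = ℕ/ R R-isEquivalence

      pointOracle : Name X → Baire
      pointOracle = proj₁

      module PointIndex (n : ℕ) =
        Index {n = n} {o = pointOracle} (oracle #0) (λ d _ → named X d) (λ d _ → named⊩ X d)

    hasTotalRepresentation : HasTotalRepresentation X
    hasTotalRepresentation = δ′ , (proj₁ (proj₂ enumeration) , λ δp≈x →
        let q , run , q⊩ = proj₂ (proj₂ enumeration) refl
        in q , run , X.⊩-resp (λ _ → refl) δp≈x q⊩) ,
      (program T , λ {p} {x} p⊩x →
        sequence T (p , x , p⊩x) , program⇓ T (p , x , p⊩x) , PointIndex.s-indexᵗ 1 (p , x , p⊩x) (0 ∷ []))
      where
      δ′ : Surjection BaireSetoid X.points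
      δ′ = record
        { to = λ p → s (p 0)
        ; cong = λ p≗q → s.cong (p≗q 0)
        ; surjective = λ x → (λ _ → index x) , λ p≗ → SX.trans (s.cong (p≗ 0)) (s-index x)
        }

      T : Term pointOracle 1
      T = PointIndex.indexᵗ 1

    isDiscreteQuotient : IsDiscreteQuotient X
    isDiscreteQuotient = R , R-isEquivalence , discrete , record
      { to = record
        { to   = index
        ; cong = λ {x} {y} x≈y → ≈⇒R (SX.trans (s-index x) (SX.trans x≈y (SX.sym (s-index y))))
        }
      ; from = record { to = s ; cong = R⇒≈ }
      ; inverse =
          (λ {x} {y} y≈sx → ≈⇒R (SX.trans (s-index y) y≈sx)) ,
          (λ {x} {y} ixRy → SX.trans (R⇒≈ ixRy) (s-index x))
      ; to-computable = program T , λ {p} {x} p⊩x →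
          sequence T (p , x , p⊩x) , program⇓ T (p , x , p⊩x) , _ , refl ,
          ≈⇒R (SX.trans (PointIndex.s-indexᵗ 1 (p , x , p⊩x) (0 ∷ [])) (SX.sym (s-index x)))
      ; from-computable = s-realised
      }
      where
      T : Term pointOracle 1
      T = PointIndex.indexᵗ 1

      s-realised : Realised X Quotient s
      s-realised = proj₁ (proj₂ enumeration) , λ { (m , p0≡m , mRn) →
        let q , run , q⊩ = proj₂ (proj₂ enumeration) p0≡m
        in q , run , X.⊩-resp (λ _ → refl) (R⇒≈ mRn) q⊩ }

      discrete : ComputablyDiscrete Quotient
      discrete = kernel⇒discrete Quotient
        (let e , kernel = pullback-kernel X Quotient s-realised equality in
         e , λ p⊩m q⊩n → let b , run , ⇔b = kernel p⊩m q⊩n in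
         b , run , mk⇔ (λ r → Equivalence.to ⇔b (R⇒≈ r)) (λ pos → ≈⇒R (Equivalence.from ⇔b pos)))

    -- The ideals of an equivalence relation are its classes.
    private
      class : X.Carrier → Ideal R
      class x = record
        { member   = λ m → True (em {P = s m X.≈ x})
        ; nonEmpty = index x , fromWitness (s-index x)
        ; lower    = λ iRj j∈ → fromWitness (SX.trans (R⇒≈ iRj) (toWitness j∈))
        ; directed = λ {i} {j} i∈ j∈ →
            j , j∈ , ≈⇒R (SX.trans (toWitness i∈) (SX.sym (toWitness j∈))) , ≈⇒R SX.refl
        }

      representative : Ideal R → X.Carrier
      representative I = s (proj₁ (Ideal.nonEmpty I))

      -- Directedness puts two members below a third, and for an equivalence relation this relates
      -- them to each other.
      ≈-representative : ∀ I {m} → Ideal.member I m → s m X.≈ representative I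
      ≈-representative I m∈ =
        let z , _ , mRz , nRz = Ideal.directed I m∈ (proj₂ (Ideal.nonEmpty I))
        in SX.trans (R⇒≈ mRz) (SX.sym (R⇒≈ nRz))

      member⇔≈ : ∀ I {x} → representative I X.≈ x → ∀ m → Ideal.member I m ⇔ (s m X.≈ x)
      member⇔≈ I I≈x m = mk⇔ (λ m∈ → SX.trans (≈-representative I m∈) I≈x)
        (λ sm≈x → Ideal.lower I (≈⇒R (SX.trans sm≈x (SX.sym I≈x))) (proj₂ (Ideal.nonEmpty I)))

    -- At k = (m , j) the output is m if entry j of the equality test confirms it. The default is
    -- the computed index of the point, itself a member of the class.
    module ClassName where

      open PointIndex 1 using (indexᵗ; s-indexᵗ)
      open Match {o = pointOracle} {n = 1} (oracle #0) (λ d _ → named X d) (λ d _ → named⊩ X d)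

      T : Term pointOracle 1
      T = caseᵗ (matchᵗ (fst #0) (snd #0)) indexᵗ (fst #0)

      T-sound : ∀ d k → s (sequence T d k) X.≈ proj₁ (proj₂ d)
      T-sound d k with match d (k ∷ []) (π₁ k) (π₂ k) in eq
      ... | zero  = s-indexᵗ d (k ∷ [])
      ... | suc _ = Equivalence.from (match⇔ d (k ∷ []) (π₁ k))
        (π₂ k , λ eq′ → contradiction (trans (sym eq) eq′) λ ())

      T-complete : ∀ d m → s m X.≈ proj₁ (proj₂ d) → ∃[ k ] sequence T d k ≡ m
      T-complete d m sm≈x =
        let j , positive = Equivalence.to (match⇔ d (0 ∷ []) m) sm≈x
            k = pair m j
        in k , trans
          (ifz-positive _ (π₁ k)
            (subst₂ (λ i j → match d (k ∷ []) i j ≢ 0) (sym (π₁-pair m j)) (sym (π₂-pair m j)) positive))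
          (π₁-pair m j)

    R-enumerable : ComputablyEnumerable R
    R-enumerable = halting T , λ i j → mk⇔ (to i j) (from i j)
      where
      o : Baire → Baire
      o _ = noOracle

      second : Baire → Vec ℕ 2 → X.Carrier
      second _ (_ ∷ ij ∷ []) = s (π₂ ij)

      secondᵗ : Term o 3
      secondᵗ = pointNameᵗ (snd #2) #0

      secondᵗ⊩ : ∀ d v → (λ k → val secondᵗ d (k ∷ v)) X.⊩ second d v
      secondᵗ⊩ _ (_ ∷ ij ∷ []) = pointName⊩ (π₂ ij)

      open Match {o = o} {n = 2} secondᵗ second secondᵗ⊩

      T : Term o 2
      T = matchᵗ (fst #1) #0

      to : ∀ i j → R i j → ∃[ z ] noOracle ⊢ halting T [ pair i j ]⇓ z
      to i j iRj = Equivalence.to (halting⇔ T noOracle (pair i j))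
        (Equivalence.to (match⇔ noOracle (0 ∷ pair i j ∷ []) (π₁ (pair i j)))
          (R⇒≈ (subst₂ R (sym (π₁-pair i j)) (sym (π₂-pair i j)) iRj)))

      from : ∀ i j → ∃[ z ] noOracle ⊢ halting T [ pair i j ]⇓ z → R i j
      from i j halts = subst₂ R (π₁-pair i j) (π₂-pair i j)
        (≈⇒R (Equivalence.from (match⇔ noOracle (0 ∷ pair i j ∷ []) (π₁ (pair i j)))
          (Equivalence.from (halting⇔ T noOracle (pair i j)) halts)))

    isPrecomputablyQuasiPolish : PrecomputablyQuasiPolish em X
    isPrecomputablyQuasiPolish = R , IsEquivalence.trans R-isEquivalence , R-enumerable , record
      { to = record
        { to   = class
        ; cong = λ x≈y m → mk⇔ (λ m∈ → fromWitness (SX.trans (toWitness m∈) x≈y))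
                               (λ m∈ → fromWitness (SX.trans (toWitness m∈) (SX.sym x≈y)))
        }
      ; from = record
        { to   = representative
        ; cong = λ {I} {J} I≈J →
            ≈-representative J (Equivalence.to (I≈J _) (proj₂ (Ideal.nonEmpty I)))
        }
      ; inverse =
          (λ {I} {x} x≈rep m → mk⇔
            (λ m∈ → Equivalence.from (member⇔≈ I (SX.sym x≈rep) m) (toWitness m∈))
            (λ m∈ → fromWitness (Equivalence.to (member⇔≈ I (SX.sym x≈rep) m) m∈))) ,
          (λ {x} {I} I≈x →
            toWitness (Equivalence.to (I≈x (proj₁ (Ideal.nonEmpty I))) (proj₂ (Ideal.nonEmpty I))))
      ; to-computable = program T , λ {p} {x} p⊩x →
        sequence T (p , x , p⊩x) , program⇓ T (p , x , p⊩x) , λ m → mk⇔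
          (λ m∈ → T-complete (p , x , p⊩x) m (toWitness m∈))
          (λ { (k , refl) → fromWitness (T-sound (p , x , p⊩x) k) })
      ; from-computable = proj₁ (proj₂ enumeration) , λ {p} {I} p⊩I →
          let q , run , q⊩ = proj₂ (proj₂ enumeration) {p = p} refl
          in q , run ,
             X.⊩-resp (λ _ → refl) (≈-representative I (Equivalence.from (p⊩I (p 0)) (0 , refl))) q⊩
      }
      where open ClassName

    -- A non-empty open set contains some `s m`, which dovetailing over m finds.
    isOvert : ComputablyOvert X
    isOvert = semidecidable⇒open (𝒪 X) (program hits , λ {u} {U} u⊩U →
      let d = u , U , u⊩U in sequence hits d , program⇓ hits d , mk⇔
        (λ { (x , x∈U) → hits-complete d (index x) (trans (Func.cong (proj₁ U) (s-index x)) x∈U) })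
        (λ { (k , positive) → s (π₁ k) , hits-sound d k positive }))
      where
      o : Name (𝒪 X) → Baire
      o = proj₁
      open Dovetail X {o = o} (oracle #0) (named (𝒪 X)) (named⊩ (𝒪 X))
        s pointName pointName⊩ (pointNameᵗ (fst #1) #0) (λ _ _ _ → refl)

  -- Enumerations from quotients and total representations.

  computableEnumeration : (X : RepresentedSpace c ℓ r) (s : ℕ → Carrier X) →
    Realised X ℕʳ s → (∀ x → ∃[ n ] RepresentedSpace._≈_ X (s n) x) → HasComputableEnumeration X
  computableEnumeration X s s-realised onto = record
    { to = s
    ; cong = λ { refl → SX.refl }
    ; surjective = λ x → let n , sn≈x = onto x in n , λ { refl → sn≈x }
    } , s-realised
    where module SX = Setoid (RepresentedSpace.points X)

  -- Each number names its own class, so `from` carries ℕ onto `X`.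
  quotient⇒enumeration : (X : RepresentedSpace c ℓ r) →
    ∀ {R : Rel ℕ 0ℓ} {isEq : IsEquivalence R} → X ≅ ℕ/ R isEq → HasComputableEnumeration X
  quotient⇒enumeration X {isEq = isEq} X≅ = computableEnumeration X (from ⟨$⟩_)
    (proj₁ from-computable , λ p0≡n → proj₂ from-computable (_ , p0≡n , IsEquivalence.refl isEq))
    (λ x → to ⟨$⟩ x , proj₂ inverse (IsEquivalence.refl isEq))
    where open _≅_ X≅

  nth : ℕ → Baire
  nth m zero    = π₁ m
  nth m (suc k) = nth (π₂ m) k

  nth-complete : ∀ K p → ∃[ m ] Agree K p (nth m)
  nth-complete zero    p = 0 , λ ()
  nth-complete (suc K) p =
    let m , agree = nth-complete K (tail p) in
    pair (p 0) m , λ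
      { {zero}  _         → sym (π₁-pair (p 0) m)
      ; {suc j} (s≤s j<K) → trans (agree j<K) (cong (λ m → nth m j) (sym (π₂-pair (p 0) m))) }

  module _ {D : Set a} {o : D → Baire} where

    nthᵗ : Term o n → Term o n → Term o n
    nthᵗ M J = ext (fst (rec J M (snd #1))) (λ d v → nth (val M d v) (val J d v))
      λ d v → lemma (val M d v) (val J d v)
      where
      shift : ∀ m k → natrec (π₂ m) (λ _ → π₂) k ≡ π₂ (natrec m (λ _ → π₂) k)
      shift m zero    = refl
      shift m (suc k) = cong π₂ (shift m k)

      lemma : ∀ m k → π₁ (natrec m (λ _ → π₂) k) ≡ nth m k
      lemma m zero    = refl
      lemma m (suc k) = trans (cong π₁ (sym (shift m k))) (lemma (π₂ m) k)

  totalRepresentation⇒enumeration : (X : RepresentedSpace c ℓ r) →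
    SemidecidableKernel X (RepresentedSpace._≈_ X) (λ x → x) →
    HasTotalRepresentation X → HasComputableEnumeration X
  totalRepresentation⇒enumeration X equality (δ′ , (e , real) , _) =
    computableEnumeration X s s-realised onto
    where
    module SX = Setoid (RepresentedSpace.points X)
    module δ′ = Surjection δ′
    Z = withTotal X δ′

    s : ℕ → Carrier X
    s m = δ′.to (nth m)

    -- Totality of `δ′` makes every sequence `nth m` a name of some point.
    realised : ∀ m → ∃[ q ] ⟦ e ⟧ (nth m) q × _⊩_ X q (s m)
    realised m = real SX.refl

    o : Name ℕʳ → Baire
    o = proj₁

    T : Term o 1
    T = via e (nthᵗ (weaken (oracle (const 0))) #0)
      (λ { (p , _) _ → proj₁ (realised (p 0)) }) (λ { (p , _) _ → proj₁ (proj₂ (realised (p 0))) }) #0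

    s-realised : Realised X ℕʳ s
    s-realised = program T , λ { {p} refl → sequence T (p , _ , refl) , program⇓ T (p , _ , refl) ,
      proj₂ (proj₂ (realised (p 0))) }

    onto : ∀ x → ∃[ m ] SX._≈_ (s m) x
    onto x =
      let p , δp≈x = δ′.strictlySurjective x
          K , local = kernel⇒locally-constant X Z 
            (pullback-kernel X Z {f = λ x → x} (e , real) equality) {p} {x} δp≈x
          m , agree = nth-complete K p
      in m , SX.sym (local SX.refl agree)

  -- The singletons are open uniformly in m, and the neighbourhoods of x include the singleton of m
  -- exactly if `R m x`. Searching the given family for a singleton therefore recovers x.
  discreteQuotient⇒admissible : ∀ {R : Rel ℕ 0ℓ} (isEq : IsEquivalence R) →
    ComputablyDiscrete (ℕ/ R isEq) → ComputablyAdmissible (ℕ/ R isEq)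
  discreteQuotient⇒admissible {R} isEq discrete = 
    g , (λ _ _ _ → R.refl) , program T , λ {p} {V} → real {p} {V}
    where
    module R = IsEquivalence isEq
    Y = ℕ/ R isEq

    kernel : SemidecidableKernel Y R (λ n → n)
    kernel = discrete⇒kernel Y discrete

    singletons : SemidecidableFamily Y R
    -- The constant sequence m names the class of m, so fixing the left argument of the equality
    -- test yields the singletons.
    singletons = proj₁ kernel , λ m → proj₂ kernel (m , refl , R.refl)

    open Sections Y singletons

    Image = Subspace (𝒪 (𝒪 Y)) λ V → ∃[ x ] IsNeighbourhoodsOf Y V x

    section∈⇔ : ∀ {V x} → IsNeighbourhoodsOf Y V x → ∀ m → (_∈_ (𝒪 Y) (section m) V) ⇔ R m x
    section∈⇔ {V} {x} nbhds m = mk⇔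
      (λ m∈V → Equivalence.to (∈-section m x) (Equivalence.to (nbhds (section m)) m∈V))
      (λ mRx → Equivalence.from (nbhds (section m)) (Equivalence.from (∈-section m x) mRx))

    g : Map Image Y
    g = record
      { to   = λ { (_ , x , _) → x }
      ; cong = λ { {V , x , v} {V′ , x′ , v′} V≈V′ →
          Equivalence.to (section∈⇔ {V′} v′ x)
            (trans (sym (V≈V′ (section x))) (Equivalence.from (section∈⇔ {V} v x) R.refl)) }
      }

    o : Name Image → Baire
    o = proj₁

    open Dovetail (𝒪 Y) {o = o} (oracle #0) (λ d → proj₁ (named Image d)) (named⊩ Image)
      section sectionName section⊩ (sectionᵗ (fst #1) #0) (λ _ _ _ → refl)

    exists : ∀ d v → ∃[ k ] val (under hits) d (k ∷ v) ≢ 0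
    exists d@(_ , (V , x , v) , _) (_ ∷ []) =
      hits-complete d x (Equivalence.from (section∈⇔ {V} v x) R.refl)

    T : Term o 1
    T = fst (searchPositive (under hits) exists)

    real : IsRealiser Image Y ⟦ program T ⟧ g
    real {p} {V , x , v} p⊩V = sequence T d , program⇓ T d , π₁ k , refl ,
      Equivalence.to (section∈⇔ {V} v (π₁ k))
        (hits-sound d k (foundPositive (under hits) exists d (0 ∷ [])))
      where
      d = p , (V , x , v) , p⊩V
      k = val (searchPositive (under hits) exists) d (0 ∷ [])

-- Quasi-Polish spaces: ideals generated by computable chains.

ifz-elim : ∀ {P : ℕ → Set} {x y} m → (m ≡ 0 → P x) → P y → P (ifz m x y)
ifz-elim zero    Px Py = Px refl
ifz-elim (suc _) Px Py = Py

unpair-triple : ∀ (f : ℕ → ℕ → ℕ → ℕ) x y z → let n = pair x (pair y z) in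
  f (π₁ n) (π₁ (π₂ n)) (π₂ (π₂ n)) ≡ f x y z
unpair-triple f x y z rewrite unpair-pair x (pair y z) | unpair-pair y z = refl

-- Putting K members in front of a listing of an ideal gives another name of it, which can thus be
-- made to agree up to K with a name of a different ideal.
splice : ℕ → Baire → Baire → Baire
splice zero    p q k       = q k
splice (suc K) p q zero    = p 0
splice (suc K) p q (suc k) = splice K (tail p) q k

splice-agree : ∀ K {p q} → Agree K p (splice K p q)
splice-agree (suc K) {j = zero}  _         = refl
splice-agree (suc K) {j = suc j} (s≤s j<K) = splice-agree K j<K

splice-all : ∀ {P : ℕ → Set} K {p q} → (∀ j → j < K → P (p j)) → (∀ j → P (q j)) →
  ∀ j → P (splice K p q j)
splice-all zero    Pp Pq j       = Pq j
splice-all (suc K) Pp Pq zero    = Pp 0 (s≤s z≤n)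
splice-all {P} (suc K) Pp Pq (suc j) = splice-all {P} K (λ i i<K → Pp (suc i) (s≤s i<K)) Pq j

splice-tail : ∀ K {p q} j → splice K p q (K + j) ≡ q j
splice-tail zero    j = refl
splice-tail (suc K) j = splice-tail K j

module QuasiPolish (em : ∀ {a} → ExcludedMiddle a) (X : RepresentedSpace c ℓ r) (x₀ : Carrier X)
  (equality : SemidecidableKernel X (RepresentedSpace._≈_ X) (λ x → x))
  {_≪_ : Rel ℕ 0ℓ} (≪-trans : Transitive _≪_) (enumerable : ComputablyEnumerable _≪_)
  (X≅𝐈 : X ≅ 𝐈 em _≪_) (overt : ComputablyOvert X) where

  open Classical em
  open Enumerations em
  open Ideal

  private
    module X = RepresentedSpace X
    module SX = Setoid X.points
    open _≅_ X≅𝐈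

    c≪ : Code
    c≪ = proj₁ enumerable

    ideal-of : X.Carrier → Ideal _≪_
    ideal-of x = to ⟨$⟩ x

    -- Opaque, as the code numbers below are too large to be evaluated.
    opaque

      contains : SemidecidableFamily X (λ m x → member (ideal-of x) m)
      contains = program T , λ m {p} {x} p⊩x → let d = m , p , x , p⊩x in
        sequence T d , program⇓ T d , mk⇔ (sound d) (complete d)
        where
        listed : ∀ ((_ , p , x , _) : ParamName X) →
          ∃[ q ] ⟦ proj₁ to-computable ⟧ p q × _⊩_ (𝐈 em _≪_) q (ideal-of x)
        listed (_ , _ , _ , p⊩x) = proj₂ to-computable p⊩x

        T : Term (paramOracle X) 1
        T = notᵗ (distinct
          (via (proj₁ to-computable) (pointᵗ X #0)
            (λ d _ → proj₁ (listed d)) (λ d _ → proj₁ (proj₂ (listed d))) #0)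
          (oracle (const 0)))

        sound : ∀ d → member (ideal-of (proj₁ (proj₂ (proj₂ d)))) (proj₁ d) → Positive (sequence T d)
        sound d@(m , _) m∈ =
          let k , eq = Equivalence.to (proj₂ (proj₂ (listed d)) m) m∈ in
          k , λ zero′ → contradiction
            (trans
              (sym (cong (λ i → ifz i 1 0) (trans (cong (λ i → distinctℕ i m) eq) (distinct-refl m))))
              zero′)
            λ ()

        complete : ∀ d → Positive (sequence T d) → member (ideal-of (proj₁ (proj₂ (proj₂ d)))) (proj₁ d)
        complete d@(m , _) (k , positive) with distinctℕ (proj₁ (listed d) k) m in eq
        ... | zero  = Equivalence.from (proj₂ (proj₂ (listed d)) m) (k , distinct⇒≡ (proj₁ (listed d) k) m eq)
        ... | suc _ = contradiction refl positive

    open Sections X contains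

    Inhabited : ℕ → Set _
    Inhabited m = ∃[ x ] member (ideal-of x) m

    nonempty : Semidecidable (𝒪 X) λ U → ∃[ x ] _∈_ X x U
    nonempty = open⇒semidecidable (𝒪 X) overt

    -- `section m` is the basic open set of points whose ideal contains m; overtness semidecides
    -- whether it is non-empty.
    probe : ∀ m → ∃[ b ] ⟦ proj₁ nonempty ⟧ (sectionName m) b × ((∃[ x ] _∈_ X x (section m)) ⇔ Positive b)
    probe m = proj₂ nonempty {sectionName m} {section m} (section⊩ m)

    inhabited : ℕ → Baire
    inhabited m = proj₁ (probe m)

    inhabited⇔ : ∀ m → Inhabited m ⇔ Positive (inhabited m)
    inhabited⇔ m = mk⇔
      (λ { (x , m∈) → Equivalence.to probe⇔ (x , Equivalence.from (∈-section m x) m∈) })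
      (λ positive → let x , x∈ = Equivalence.from probe⇔ positive in x , Equivalence.to (∈-section m x) x∈)
      where probe⇔ = proj₂ (proj₂ (probe m))

    o : Unit → Baire
    o _ = noOracle

    -- The default of `generator`. An enumeration by ℕ presupposes a point, and `x₀` supplies this
    -- number.
    m₀ : ℕ
    m₀ = proj₁ (nonEmpty (ideal-of x₀))

    opaque

      generator : ℕ → ℕ
      generator j = ifz (inhabited (π₁ j) (π₂ j)) m₀ (π₁ j)

      generator-case : ∀ j → ifz (inhabited (π₁ j) (π₂ j)) m₀ (π₁ j) ≡ generator j
      generator-case j = refl

      generator-inhabited : ∀ j → Inhabited (generator j)
      generator-inhabited j with inhabited (π₁ j) (π₂ j) in eq
      ... | zero  = x₀ , proj₂ (nonEmpty (ideal-of x₀))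
      ... | suc _ = Equivalence.from (inhabited⇔ (π₁ j))
        (π₂ j , λ zero′ → contradiction (trans (sym eq) zero′) λ ())

      generator-onto : ∀ {m} → Inhabited m → ∃[ j ] generator j ≡ m
      generator-onto {m} inh =
        let k , positive = Equivalence.to (inhabited⇔ m) inh
            j = pair m k
        in j , trans
          (ifz-positive m₀ (π₁ j)
            (subst₂ (λ i k → inhabited i k ≢ 0) (sym (π₁-pair m k)) (sym (π₂-pair m k)) positive))
          (π₁-pair m k)

      -- Vanishes once the enumeration of ≪ has confirmed m ≪ n at stage t.
      unconfirmed : ℕ → ℕ → ℕ → ℕ
      unconfirmed m n t = π₂ (stage noOracle (encode c≪) (pair m n) t)

      unconfirmed-stage : ∀ m n t → π₂ (stage noOracle (encode c≪) (pair m n) t) ≡ unconfirmed m n t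
      unconfirmed-stage m n t = refl

      confirmed-sound : ∀ m n t → unconfirmed m n t ≡ 0 → m ≪ n
      confirmed-sound m n t eq =
        Equivalence.from (proj₂ enumerable m n) (_ , halted noOracle c≪ refl (pair m n) t eq)

      confirmed-complete : ∀ {m n} → m ≪ n → ∃[ t ] unconfirmed m n t ≡ 0
      confirmed-complete {m} {n} m≪n = halts refl (proj₂ (Equivalence.to (proj₂ enumerable m n) m≪n))

    generatorᵗ : Term o n → Term o n
    generatorᵗ J = ext
      (caseᵗ
        (via (proj₁ nonempty) (sectionᵗ (weaken (fst J)) #0) (λ d v → inhabited (π₁ (val J d v)))
          (λ d v → proj₁ (proj₂ (probe (π₁ (val J d v))))) (snd J))
        (const m₀) (fst J))
      (λ d v → generator (val J d v)) (λ d v → generator-case (val J d v))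

    unconfirmedᵗ : Term o n → Term o n → Term o n → Term o n
    unconfirmedᵗ M N T = ext (snd (stageᵗ (const 0) (const (encode c≪)) ⟪ M , N ⟫ T))
      (λ d v → unconfirmed (val M d v) (val N d v) (val T d v))
      (λ d v → unconfirmed-stage (val M d v) (val N d v) (val T d v))

    opaque

      above : Term o 2
      above = unconfirmedᵗ (generatorᵗ #1) (generatorᵗ (fst #0)) (snd #0)

      -- Directedness applied to a member twice yields a member above it in the same ideal, which
      -- `generator` must then list.
      above-exists : ∀ d v → ∃[ i ] val above d (i ∷ v) ≡ 0
      above-exists d (j ∷ []) =
        let x , m∈           = generator-inhabited j
            z , z∈ , m≪z , _ = directed (ideal-of x) m∈ m∈
            k , k≡z          = generator-onto (x , z∈)
            t , eq           = confirmed-complete (subst (generator j ≪_) (sym k≡z) m≪z)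
        in pair k t ,
           subst₂ (λ k t → unconfirmed (generator j) (generator k) t ≡ 0)
             (sym (π₁-pair k t)) (sym (π₂-pair k t)) eq

      -- Acts on indices of `generator`, so that every element of the chain again belongs to some
      -- ideal and the search can continue.
      successorᵗ : Term o 1
      successorᵗ = fst (search above above-exists)

      successor-≪ : ∀ j → generator j ≪ generator (val successorᵗ tt (j ∷ []))
      successor-≪ j = confirmed-sound (generator j) (generator (val successorᵗ tt (j ∷ [])))
        (π₂ (val (search above above-exists) tt (j ∷ []))) (found above above-exists tt (j ∷ []))

    successor : ℕ → ℕ
    successor j = val successorᵗ tt (j ∷ [])

    element : ℕ → ℕ → ℕ
    element j i = generator (natrec j (λ _ → successor) i)

    element-≪ : ∀ j i → element j i ≪ element j (suc i)
    element-≪ j i = successor-≪ (natrec j (λ _ → successor) i)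

    element-lift : ∀ {m j i} k → m ≪ element j i → m ≪ element j (k + i)
    element-lift zero    m≪ = m≪
    element-lift (suc k) m≪ = ≪-trans (element-lift k m≪) (element-≪ _ (k + _))

    -- `≪` need not be reflexive: the members lie strictly along `≪` below the chain, and a chain
    -- element is a member through its successor.
    generated : ℕ → Ideal _≪_
    generated j = record
      { member   = λ m → ∃[ i ] m ≪ element j i
      ; nonEmpty = generator j , 1 , element-≪ j 0
      ; lower    = λ { m≪n (i , n≪) → i , ≪-trans m≪n n≪ }
      ; directed = λ { {m} {n} (i , m≪) (i′ , n≪) →
          element j (i′ + i) , (suc (i′ + i) , element-≪ j (i′ + i)) ,
          element-lift i′ m≪ ,
          subst (λ k → n ≪ element j k) (+-comm i i′) (element-lift i n≪) }
      }

    opaque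

      -- The default `generator j` starts the chain and is a member by `element-≪ j 0`.
      entry : (j m i t : ℕ) → ℕ
      entry j m i t = ifz (unconfirmed m (element j i) t) m (generator j)

      entry-case : ∀ j m i t → ifz (unconfirmed m (element j i) t) m (generator j) ≡ entry j m i t
      entry-case j m i t = refl

      entry-sound : ∀ j m i t → member (generated j) (entry j m i t)
      entry-sound j m i t = ifz-elim {P = member (generated j)} (unconfirmed m (element j i) t)
        (λ eq → i , confirmed-sound m (element j i) t eq) (1 , element-≪ j 0)

      entry-complete : ∀ {j m i} → m ≪ element j i → ∃[ t ] entry j m i t ≡ m
      entry-complete {j} {m} {i} m≪ = let t , eq = confirmed-complete m≪ in
        t , cong (λ u → ifz u m (generator j)) eq

    listing : ℕ → Baire
    listing j k = entry j (π₁ k) (π₁ (π₂ k)) (π₂ (π₂ k))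

    listing⊩ : ∀ j → _⊩_ (𝐈 em _≪_) (listing j) (generated j)
    listing⊩ j m = mk⇔ complete (λ { (k , refl) → entry-sound j (π₁ k) (π₁ (π₂ k)) (π₂ (π₂ k)) })
      where
      complete : member (generated j) m → ∃[ k ] listing j k ≡ m
      complete (i , m≪) =
        let t , eq = entry-complete m≪ in
        pair m (pair i t) , trans (unpair-triple (entry j) m i t) eq

    opaque

      listing-computable : ∃[ e ] ⟦ e ⟧ noOracle (λ k → listing (π₁ k) (π₂ k))
      listing-computable = program T , program⇓ T tt
        where
        entryᵗ : (J M I T : Term o n) → Term o n
        entryᵗ J M I T = ext
          (caseᵗ (unconfirmedᵗ M (generatorᵗ (rec I J (successorᵗ ∙ #1))) T) M (generatorᵗ J))
          (λ d v → entry (val J d v) (val M d v) (val I d v) (val T d v))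
          (λ d v → entry-case (val J d v) (val M d v) (val I d v) (val T d v))

        T : Term o 1
        T = let k = snd #0 in entryᵗ (fst #0) (fst k) (fst (snd k)) (snd (snd k))

    point : ℕ → X.Carrier
    point j = from ⟨$⟩ generated j

    point-realised : Realised X ℕʳ point
    point-realised = program T , λ { {p} refl →
      sequence T (p , p 0 , refl) , program⇓ T (p , p 0 , refl) ,
      proj₂ (proj₂ (realised (p 0))) }
      where
      realised : ∀ j → ∃[ q ] ⟦ proj₁ from-computable ⟧ (listing j) q × q X.⊩ point j
      realised j = proj₂ from-computable (listing⊩ j)

      oᴺ : Name ℕʳ → Baire
      oᴺ = proj₁

      listingᵗ : Term oᴺ n → Term oᴺ n → Term oᴺ n
      listingᵗ J K = ext
        (via (proj₁ listing-computable) (const 0) (λ _ _ k → listing (π₁ k) (π₂ k))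
          (λ _ _ → proj₂ listing-computable) ⟪ J , K ⟫)
        (λ d v → listing (val J d v) (val K d v))
        λ d v → cong₂ listing (π₁-pair (val J d v) (val K d v)) (π₂-pair (val J d v) (val K d v))

      T : Term oᴺ 1
      T = via (proj₁ from-computable) (listingᵗ (oracle (const 0)) #0)
        (λ { (p , _) _ → proj₁ (realised (p 0)) }) (λ { (p , _) _ → proj₁ (proj₂ (realised (p 0))) }) #0

    -- Each step replaces the bound by one that is also above the next entry; transitivity preserves
    -- the earlier inequalities.
    upper-bound : ∀ (I : Ideal _≪_) (p : Baire) → (∀ k → member I (p k)) → ∀ K →
      ∃[ z ] member I z × (∀ k → k < K → p k ≪ z)
    upper-bound I p p∈ zero    = proj₁ (nonEmpty I) , proj₂ (nonEmpty I) , λ _ ()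
    upper-bound I p p∈ (suc K) =
      let z , z∈ , below         = upper-bound I p p∈ K
          z′ , z′∈ , z≪z′ , pK≪z′ = directed I z∈ (p∈ K)
      in z′ , z′∈ , λ k k<1+K → extend below z≪z′ pK≪z′ (m≤n⇒m<n∨m≡n (s≤s⁻¹ k<1+K))
      where
      extend : ∀ {z z′ k} → (∀ k → k < K → p k ≪ z) → z ≪ z′ → p K ≪ z′ → k < K ⊎ k ≡ K → p k ≪ z′
      extend below z≪z′ _     (inj₁ k<K)  = ≪-trans (below _ k<K) z≪z′
      extend below _    pK≪z′ (inj₂ refl) = pK≪z′

    -- Only a finite part of a name of the ideal of x matters for the equality
    -- test, and a generated ideal can contain any finite part of it.
    point-onto : ∀ x → ∃[ j ] point j X.≈ x
    point-onto x =
      let I = ideal-of x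
          p , p⊩I = RepresentedSpace.surjective (𝐈 em _≪_) I
          K , local = kernel⇒locally-constant X (𝐈 em _≪_)
            (pullback-kernel X (𝐈 em _≪_) {f = from ⟨$⟩_} from-computable equality) {p} {I} p⊩I
          z , z∈ , below = upper-bound I p (λ k → Equivalence.from (p⊩I (p k)) (k , refl)) K
          j , j≡z = generator-onto (x , z∈)
          spliced = splice K p (listing j)
          spliced⊩ : _⊩_ (𝐈 em _≪_) spliced (generated j)
          spliced⊩ = λ m → mk⇔
            (λ m∈ → let k , eq = Equivalence.to (listing⊩ j m) m∈ in K + k , trans (splice-tail K k) eq)
            (λ { (k , refl) → splice-all {member (generated j)} K
                   (λ i i<K → 0 , subst (p i ≪_) (sym j≡z) (below i i<K))
                   (λ i → Equivalence.from (listing⊩ j (listing j i)) (i , refl)) k })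
      in j , SX.trans (SX.sym (local {z′ = generated j} spliced⊩ (splice-agree K)))
                      (proj₂ inverse {x} {I} (λ m → mk⇔ (λ y → y) (λ y → y)))

  hasComputableEnumeration : HasComputableEnumeration X
  hasComputableEnumeration = computableEnumeration X point point-realised point-onto

theorem14 : (em : ∀ {a} → ExcludedMiddle a) →
    ∀ {c ℓ r} (X : RepresentedSpace c ℓ r) →
    RepresentedSpace.Carrier X →
    ComputablyDiscrete X →
    (HasTotalRepresentation X ⇔ HasComputableEnumeration X) ×
    (HasComputableEnumeration X ⇔ ComputablyQuasiPolish em X) ×
    (ComputablyQuasiPolish em X ⇔ IsDiscreteQuotient X) ×
    (IsDiscreteQuotient X ⇔ IsAdmissibleQuotient X)
theorem14 em X x₀ discrete =
  mk⇔ (totalRepresentation⇒enumeration X equality) (Enumerated.hasTotalRepresentation X equality) ,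
  mk⇔ enumeration⇒quasiPolish quasiPolish⇒enumeration ,
  mk⇔ (λ quasiPolish → Enumerated.isDiscreteQuotient X equality (quasiPolish⇒enumeration quasiPolish))
      (λ { (_ , _ , _ , X≅ℕ/R) → enumeration⇒quasiPolish (quotient⇒enumeration X X≅ℕ/R) }) ,
  mk⇔ (λ { (R , isEq , discrete′ , X≅ℕ/R) →
        R , isEq , discreteQuotient⇒admissible isEq discrete′ , X≅ℕ/R })
      -- The relation is rebuilt from the enumeration that the given quotient induces, with the
      -- equality test of `X` making it discrete.
      (λ { (_ , _ , _ , X≅ℕ/R) →
        Enumerated.isDiscreteQuotient X equality (quotient⇒enumeration X X≅ℕ/R) })
  where
  open Classical em
  open Enumerations em

  equality : SemidecidableKernel X (RepresentedSpace._≈_ X) (λ x → x)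
  equality = discrete⇒kernel X discrete

  enumeration⇒quasiPolish : HasComputableEnumeration X → ComputablyQuasiPolish em X
  enumeration⇒quasiPolish enumeration =
    Enumerated.isPrecomputablyQuasiPolish X equality enumeration , Enumerated.isOvert X equality enumeration

  quasiPolish⇒enumeration : ComputablyQuasiPolish em X → HasComputableEnumeration X
  quasiPolish⇒enumeration ((_ , ≪-trans , enumerable , X≅𝐈) , overt) =
    QuasiPolish.hasComputableEnumeration em X x₀ equality
      (λ {i} {j} {k} → ≪-trans {i} {j} {k}) enumerable X≅𝐈 overt
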